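{- Let $\Delta=3$, let $r$ be divisible by $6$, and let $G=(V,E)$ be a nice graph with maximum degree $\Delta=3$ that does not contain any degree-choosable components of radius at most $r$. Apply the marking process to $G$ with backoff distance $b=15$ (with any outcome of its randomness). Let $v\in V$ be an arbitrary unmarked node. If $\deg_G(u)=\Delta$ for each $u\in N_r(v)$, then the $r$-hop connected component of unmarked nodes around $v$ contains a $T$-node or at least $4^{r/6}$ nodes.
   Context: Graphs are finite, simple and undirected. A nice graph is a connected graph that is neither a path, a cycle, nor a clique. A degree-choosable component (DCC) of $G$ is a node-induced subgraph of $G$ that is 2-connected and is neither a clique nor an odd cycle; its radius is the radius of the induced subgraph. $N_r(v)$ is the set of nodes at distance at most $r$ from $v$ in $G$. Marking process with selection probability $p$ and backoff distance $b$, on an initially uncolored graph $G$: each node selects itself independently with probability $p$. Then, if there is another selected node within distance $b$ of a selected node, that node unselects itself (so the nodes remaining selected have pairwise distance greater than $b$). Otherwise the selected node picks two non-adjacent neighbors and colors them with color one; these two neighbors are called marked. All other nodes are unmarked (uncolored). A $T$-node is a node with two neighbors in $G$ that have the same color (i.e. two marked neighbors); in particular each node that stays selected and marks two neighbors is a $T$-node. The $r$-hop connected component of unmarked nodes around $v$ is the set of nodes reachable from $v$ by paths of length at most $r$ consisting of unmarked nodes. -}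

module Defs where

open import Level using (0ℓ)
open import Data.Empty using (⊥)
open import Data.Fin using (Fin; toℕ)
open import Data.Fin.Subset using (Subset; _∈_; _∉_; ⊤; ∣_∣; _-_)
open import Data.Nat using (ℕ; zero; suc; _≤_)
open import Data.Nat.Divisibility using (_∣_)
open import Data.Product using (∃-syntax; _×_)
open import Data.Sum using (_⊎_)
open import Function.Bundles using (_⇔_)
open import Function.Definitions using (Injective)
open import Relation.Binary using (Rel)
open import Relation.Binary.PropositionalEquality using (_≡_; _≢_)
open import Relation.Nullary using (¬_; Dec; yes; no)
open import Relation.Unary using (Pred; U)

PathAdj : (m : ℕ) → Rel (Fin m) 0ℓ
PathAdj m i j = toℕ j ≡ suc (toℕ i) ⊎ toℕ i ≡ suc (toℕ j)

CycleAdj : (m : ℕ) → Rel (Fin m) 0ℓ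
CycleAdj m i j = PathAdj m i j
               ⊎ (toℕ i ≡ 0 × suc (toℕ j) ≡ m)
               ⊎ (toℕ j ≡ 0 × suc (toℕ i) ≡ m)

record Graph (n : ℕ) : Set where
  field
    nbhd       : Fin n → Subset n
    symmetric  : ∀ {u v} → u ∈ nbhd v → v ∈ nbhd u
    loopless   : ∀ v → v ∉ nbhd v

  Adj : Rel (Fin n) 0ℓ
  Adj u v = v ∈ nbhd u

  deg : Fin n → ℕ
  deg v = ∣ nbhd v ∣

module _ {n : ℕ} (G : Graph n) where
  open Graph G

  MaxDegree : ℕ → Set
  MaxDegree Δ = (∀ v → deg v ≤ Δ) × (∃[ v ] deg v ≡ Δ)

  -- Walk P u v k: a walk from u to v with k edges, all of whose nodes,
  -- endpoints included, satisfy P.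
  data Walk (P : Pred (Fin n) 0ℓ) : Fin n → Fin n → ℕ → Set where
    stop : ∀ {v} → P v → Walk P v v zero
    step : ∀ {u v w k} → P u → Adj u v → Walk P v w k → Walk P u w (suc k)

  -- Distance at most k in the subgraph induced by P.
  Within : Pred (Fin n) 0ℓ → ℕ → Rel (Fin n) 0ℓ
  Within P k u v = ∃[ l ] l ≤ k × Walk P u v l

  N : ℕ → Fin n → Pred (Fin n) 0ℓ
  N r v u = Within U r v u

  -- The predicates below on S : Subset n are properties of the induced
  -- subgraph G[S]; the whole graph is S = ⊤.

  Connected : Subset n → Set
  Connected S = ∀ {u v} → u ∈ S → v ∈ S → ∃[ k ] Walk (_∈ S) u v k

  TwoConnected : Subset n → Set
  TwoConnected S = 3 ≤ ∣ S ∣ × Connected S × (∀ {x} → x ∈ S → Connected (S - x))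

  Clique : Subset n → Set
  Clique S = ∀ {u v} → u ∈ S → v ∈ S → u ≢ v → Adj u v

  -- An isomorphism from the graph (Fin m , R) to G[S].
  record Iso (S : Subset n) {m : ℕ} (R : Rel (Fin m) 0ℓ) : Set where
    field
      node      : Fin m → Fin n
      injective : Injective _≡_ _≡_ node
      image     : ∀ u → u ∈ S ⇔ (∃[ i ] node i ≡ u)
      adjacency : ∀ i j → Adj (node i) (node j) ⇔ R i j

  IsPath : Subset n → Set
  IsPath S = ∃[ m ] 1 ≤ m × Iso S (PathAdj m)

  IsCycle : Subset n → Set
  IsCycle S = ∃[ m ] 3 ≤ m × Iso S (CycleAdj m)

  IsOddCycle : Subset n → Set
  IsOddCycle S = ∃[ m ] 3 ≤ m × ¬ (2 ∣ m) × Iso S (CycleAdj m)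

  Nice : Set
  Nice = Connected ⊤ × ¬ IsPath ⊤ × ¬ IsCycle ⊤ × ¬ Clique ⊤

  DCC : Subset n → Set
  DCC S = TwoConnected S × ¬ Clique S × ¬ IsOddCycle S

  -- Distances are measured inside G[S], not in G.
  RadiusAtMost : ℕ → Subset n → Set
  RadiusAtMost r S = ∃[ c ] c ∈ S × (∀ {u} → u ∈ S → Within (_∈ S) r c u)

  record NonAdjacentNeighbours (s : Fin n) : Set where
    field
      x y         : Fin n
      x-neighbour : Adj s x
      y-neighbour : Adj s y
      distinct    : x ≢ y
      nonadjacent : ¬ Adj x y

  -- One outcome of the randomness of the marking process with backoff
  -- distance b.  Any set of nodes can be the set of initially selected ones.
  -- A choice of neighbours is recorded for every node, but only the choices of
  -- nodes that stay selected are used; a node may forgo choosing only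
  -- if it has no two non-adjacent neighbours (possible when its degree is
  -- below the maximum), and then it marks nothing.
  record Marking (b : ℕ) : Set where
    field
      selected : Subset n
      pick     : ∀ s → Dec (NonAdjacentNeighbours s)

    StaysSelected : Pred (Fin n) 0ℓ
    StaysSelected s =
      s ∈ selected × (∀ {t} → t ∈ selected → t ≢ s → ¬ Within U b s t)

    Picked : ∀ {s} → Dec (NonAdjacentNeighbours s) → Pred (Fin n) 0ℓ
    Picked (yes p) u = u ≡ NonAdjacentNeighbours.x p ⊎ u ≡ NonAdjacentNeighbours.y p
    Picked (no _)  u = ⊥

    Marked : Pred (Fin n) 0ℓ
    Marked u = ∃[ s ] StaysSelected s × Picked (pick s) u

    Unmarked : Pred (Fin n) 0ℓ
    Unmarked u = ¬ Marked u

    -- Marked nodes are exactly the coloured ones, and all have colour one, so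
    -- two neighbours have the same colour iff both are marked.
    TNode : Pred (Fin n) 0ℓ
    TNode u = ∃[ x ] ∃[ y ] x ≢ y × Adj u x × Adj u y × Marked x × Marked y

    HopComponent : ℕ → Fin n → Pred (Fin n) 0ℓ
    HopComponent r v u = Within Unmarked r v u

-- P holds of at least k elements.
AtLeast : ∀ {n} → ℕ → Pred (Fin n) 0ℓ → Set
AtLeast {n} k P = ∃[ S ] k ≤ ∣ S ∣ × (∀ {u : Fin n} → u ∈ S → P u)

{-# OPTIONS --safe #-}
-- Layer G by the distance from v.  Two overlapping cycles, or an even one, give a DCC whose
-- radius is at most r because each of its nodes is joined to the topmost node by parents.
-- Hence within distance r parents are unique, a node has at most one horizontal edge, and a
-- node and its parent do not both have one; so a node has two children, or it has one child
-- and this child has two.  Without marks, the number of descendants thus doubles every two levels.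
--
-- Suppose no T-node is reached, and call a reached node with a marked child an event.  Two
-- events close to each other come from the two marks of one selected node s.  Then their
-- levels differ by one, and the cycle through s and its marks forbids horizontal edges nearby;
-- in particular a node whose only child is marked is not one of two such events.  Therefore
-- every node with an unmarked child has, six levels below, four descendants that again have
-- an unmarked child.
module Submission where

open import Level using (0ℓ)
open import Data.Empty using (⊥-elim) renaming (⊥ to ⊥ᵗ)
open import Data.Fin using (Fin; zero; suc; toℕ)
open import Data.Fin.Properties using (any?; all?; toℕ-injective; toℕ<n) renaming (_≟_ to _≟ᶠ_)
open import Data.Fin.Subset using (Subset; _∈_; _∉_; ⊤; ⊥; ∣_∣; _-_; _∪_; ⁅_⁆; inside; outside; Nonempty)
open import Data.Fin.Subset.Properties
open import Data.List using (List; []; _∷_; length; _++_; tabulate)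
open import Data.List.Properties using (length-++; length-tabulate)
open import Data.List.Relation.Unary.All as All using (All; []; _∷_)
import Data.List.Relation.Unary.All.Properties as Allₚ
open import Data.List.Relation.Unary.Any as Any using (Any; here; there)
open import Data.List.Relation.Unary.AllPairs using ([]; _∷_)
open import Data.List.Relation.Unary.Unique.Propositional using (Unique)
import Data.List.Relation.Unary.Unique.Propositional.Properties as Uniqueₚ
open import Data.Nat hiding (∣_-_∣)
open import Data.Nat.DivMod using (_/_; m*n/n≡m)
open import Data.Nat.Divisibility using (_∣_; divides)
open import Data.Nat.Properties
open import Data.Product using (∃-syntax; _×_; _,_; proj₁; proj₂)
open import Data.Sum using (_⊎_; inj₁; inj₂; [_,_]′)
open import Data.Vec using (here; there; _∷_)
open import Function using (_∘_; case_of_)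
open import Function.Bundles using (Equivalence)
open import Relation.Binary.Definitions using (tri<; tri≈; tri>)
open import Relation.Binary.PropositionalEquality
open import Relation.Nullary using (¬_; Dec; yes; no)
open import Relation.Nullary.Decidable using (_×-dec_; _⊎-dec_; _→-dec_; ¬?; map′)
open import Relation.Unary using (Pred; U; Decidable)
open import Defs

-- A branch of the descent stops only at a node whose single child is marked. Counting descendants
-- is therefore not enough: the nodes at the bottom of a block of six levels must again have an
-- unmarked child, or the next block could not start from them. Four mark-free levels already give a
-- factor of four; the other two levels pay for the branches that marks cut off and for the leaves
-- that are dead ends.
--
-- The backoff distance is 2 + 11 + 2: an event is two steps away from the node that made the mark,
-- and the farthest events to be compared are a leaf six levels down and an event at most five
-- levels down.
--
-- Speaking about a leaf involves two more levels, those of its marked child and of that child's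
-- marker, so a full block needs eight levels above the limit `r`. In the last block only six are
-- guaranteed. There nodes are counted anywhere in the block instead of at its bottom, and four of
-- them are found without asking that they can continue.

-- Cardinalities of finite subsets.

∣p∪⁅x⁆∣≡1+∣p∣ : ∀ {n} (p : Subset n) x → x ∉ p → ∣ p ∪ ⁅ x ⁆ ∣ ≡ suc ∣ p ∣
∣p∪⁅x⁆∣≡1+∣p∣ (inside  ∷ p) zero    x∉p = ⊥-elim (x∉p here)
∣p∪⁅x⁆∣≡1+∣p∣ (outside ∷ p) zero    x∉p = cong (suc ∘ ∣_∣) (∪-identityʳ p)
∣p∪⁅x⁆∣≡1+∣p∣ (inside  ∷ p) (suc x) x∉p = cong suc (∣p∪⁅x⁆∣≡1+∣p∣ p x (x∉p ∘ there))
∣p∪⁅x⁆∣≡1+∣p∣ (outside ∷ p) (suc x) x∉p = ∣p∪⁅x⁆∣≡1+∣p∣ p x (x∉p ∘ there)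

∣p∣≤1+∣p-x∣ : ∀ {n} (p : Subset n) x → ∣ p ∣ ≤ suc ∣ p - x ∣
∣p∣≤1+∣p-x∣ (inside  ∷ p) zero    = s≤s (≤-reflexive (cong ∣_∣ (sym (p─⊥≡p p))))
∣p∣≤1+∣p-x∣ (outside ∷ p) zero    = m≤n⇒m≤1+n (≤-reflexive (cong ∣_∣ (sym (p─⊥≡p p))))
∣p∣≤1+∣p-x∣ (inside  ∷ p) (suc x) = s≤s (∣p∣≤1+∣p-x∣ p x)
∣p∣≤1+∣p-x∣ (outside ∷ p) (suc x) = ∣p∣≤1+∣p-x∣ p x

x∈p-y⁻ : ∀ {n} (p : Subset n) x y → x ∈ p - y → x ∈ p × x ≢ y
x∈p-y⁻ p x y x∈ = p─q⊆p p ⁅ y ⁆ x∈ , λ { refl → x∉p-x p x x∈ }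
  where
  x∉p-x : ∀ {n} (p : Subset n) x → x ∉ p - x
  x∉p-x (_ ∷ p) (suc x) (there h) = x∉p-x p x h

x∈p∪⁅y⁆⁻ : ∀ {n} (p : Subset n) {x} y → x ∈ p ∪ ⁅ y ⁆ → x ∈ p ⊎ x ≡ y
x∈p∪⁅y⁆⁻ p y h with x∈p∪q⁻ p ⁅ y ⁆ h
... | inj₁ x∈p = inj₁ x∈p
... | inj₂ x∈y = inj₂ (x∈⁅y⁆⇒x≡y y x∈y)

x∈p∪⁅x⁆ : ∀ {n} (p : Subset n) x → x ∈ p ∪ ⁅ x ⁆
x∈p∪⁅x⁆ p x = q⊆p∪q p ⁅ x ⁆ (x∈⁅x⁆ x)

Unique⇒length≤∣p∣ : ∀ {n} (p : Subset n) {xs} → Unique xs → All (_∈ p) xs → length xs ≤ ∣ p ∣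
Unique⇒length≤∣p∣ p []         []           = z≤n
Unique⇒length≤∣p∣ p (x∉ ∷ uxs) (x∈p ∷ xs∈p) = ≤-trans
  (s≤s (Unique⇒length≤∣p∣ (p - _) uxs
    (All.map (λ { (y∈p , x≢y) → x∈p∧x≢y⇒x∈p-y y∈p (x≢y ∘ sym) }) (All.zip (xs∈p , x∉)))))
  (x∈p⇒∣p-x∣<∣p∣ x∈p)

0<∣p∣⇒Nonempty : ∀ {n} (p : Subset n) → 0 < ∣ p ∣ → Nonempty p
0<∣p∣⇒Nonempty {n} p 0<p with nonempty? p
... | yes ne = ne
... | no  e  = ⊥-elim (<-irrefl (sym (trans (cong ∣_∣ (Empty-unique e)) (∣⊥∣≡0 n))) 0<p)

fresh : ∀ {n} (p : Subset n) (xs : List (Fin n)) → length xs < ∣ p ∣ →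
        ∃[ x ] x ∈ p × All (x ≢_) xs
fresh p []       l< = let x , x∈p = 0<∣p∣⇒Nonempty p l< in x , x∈p , []
fresh p (y ∷ xs) l< =
  let x , x∈ , x∉xs = fresh (p - y) xs (s≤s⁻¹ (≤-trans l< (∣p∣≤1+∣p-x∣ p y)))
      x∈p , x≢y     = x∈p-y⁻ p x y x∈
  in x , x∈p , x≢y ∷ x∉xs

covered⇒∣p∣≤ : ∀ {n m} (p : Subset n) (f : Fin m → Fin n) →
               (∀ {x} → x ∈ p → ∃[ i ] f i ≡ x) → ∣ p ∣ ≤ m
covered⇒∣p∣≤ {m = m} p f cover with ∣ p ∣ ≤? m
... | yes le = le
... | no  gt with fresh p (tabulate f) (subst (_< ∣ p ∣) (sym (length-tabulate f)) (≰⇒> gt))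
...   | x , x∈p , x∉ = let i , eq = cover x∈p in ⊥-elim (Allₚ.tabulate⁻ x∉ i (sym eq))

-- Walks and bounded distance.

module _ {n : ℕ} (G : Graph n) where
  open Graph G

  private variable
    P Q : Pred (Fin n) 0ℓ
    u v w : Fin n
    k l : ℕ

  adj-sym : Adj u v → Adj v u
  adj-sym = symmetric

  Adj⇒≢ : Adj u v → u ≢ v
  Adj⇒≢ uv refl = loopless _ uv

  adj? : ∀ u v → Dec (Adj u v)
  adj? u v = v ∈? nbhd u

  head : Walk G P u v k → P u
  head (stop p)     = p
  head (step p _ _) = p

  mapWalk : (∀ {x} → P x → Q x) → Walk G P u v k → Walk G Q u v k
  mapWalk f (stop p)      = stop (f p)
  mapWalk f (step p e ws) = step (f p) e (mapWalk f ws)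

  _▻_ : Walk G P u v k → Walk G P v w l → Walk G P u w (k + l)
  stop _      ▻ vs = vs
  step p e us ▻ vs = step p e (us ▻ vs)

  snoc : Walk G P u v k → Adj v w → P w → Walk G P u w (suc k)
  snoc (stop p)      e q = step p e (stop q)
  snoc (step p d us) e q = step p d (snoc us e q)

  reverse : Walk G P u v k → Walk G P v u k
  reverse (stop p)      = stop p
  reverse (step p e us) = snoc (reverse us) (adj-sym e) p

  unsnoc : Walk G P u w (suc k) → ∃[ v ] Walk G P u v k × Adj v w × P w
  unsnoc (step p e (stop q)) = _ , stop p , e , q
  unsnoc (step p e us@(step _ _ _)) =
    let v , us′ , e′ , q = unsnoc us in v , step p e us′ , e′ , q

  walk? : Decidable P → ∀ u v k → Dec (Walk G P u v k)
  walk? P? u v zero = map′ (λ { (refl , p) → stop p }) (λ { (stop p) → refl , p })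
                        (u ≟ᶠ v ×-dec P? u)
  walk? P? u v (suc k) =
    map′ (λ { (p , _ , e , ws) → step p e ws }) (λ { (step p e ws) → p , _ , e , ws })
      (P? u ×-dec any? (λ w → adj? u w ×-dec walk? P? w v k))

  within? : Decidable P → ∀ k u v → Dec (Within G P k u v)
  within? P? k u v =
    map′ (λ { (l , l<1+k , ws) → l , s≤s⁻¹ l<1+k , ws })
         (λ { (l , l≤k , ws) → l , s≤s l≤k , ws })
         (anyUpTo? (walk? P? u v) (suc k))

  within-sym : Within G P k u v → Within G P k v u
  within-sym (l , l≤k , ws) = l , l≤k , reverse ws

  within-trans : Within G P k u v → Within G P l v w → Within G P (k + l) u w
  within-trans (i , i≤k , us) (j , j≤l , vs) = i + j , +-mono-≤ i≤k j≤l , us ▻ vs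

  within-≤ : k ≤ l → Within G P k u v → Within G P l u v
  within-≤ k≤l (i , i≤k , us) = i , ≤-trans i≤k k≤l , us

  Linked : Pred (Fin n) 0ℓ → Fin n → Fin n → Set
  Linked P u v = ∃[ k ] Walk G P u v k

  linked-sym : Linked P u v → Linked P v u
  linked-sym (_ , us) = _ , reverse us

  linked-trans : Linked P u v → Linked P v w → Linked P u w
  linked-trans (_ , us) (_ , vs) = _ , us ▻ vs

  linked-map : (∀ {x} → P x → Q x) → Linked P u v → Linked Q u v
  linked-map f (_ , us) = _ , mapWalk f us

  linked-snoc : Linked P u v → Adj v w → P w → Linked P u w
  linked-snoc (_ , us) e q = _ , snoc us e q

  linked-refl : P u → Linked P u u
  linked-refl p = _ , stop p

-- Distance layers and parents.

record Distances {n : ℕ} (G : Graph n) (v : Fin n) : Set where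
  open Graph G
  field
    level    : Fin n → ℕ
    geodesic : ∀ u → Walk G U v u (level u)
    shortest : ∀ {u k} → Walk G U v u k → level u ≤ k

  adj-level : ∀ {u w} → Adj u w → level w ≤ suc (level u)
  adj-level uw = shortest (snoc G (geodesic _) uw _)

  level≡0⇒source : ∀ {u} → level u ≡ 0 → u ≡ v
  level≡0⇒source {u} eq with level u | geodesic u
  level≡0⇒source refl | .0 | stop _ = refl

  private
    ∃parent : ∀ u → ∃[ p ] (0 < level u → Adj u p × suc (level p) ≡ level u)
    ∃parent u with level u in eq | geodesic u
    -- The source serves as its own parent. This value is never a neighbour, so excluding the parent
    -- from the neighbours of the source removes nothing.
    ... | zero  | _  = u , λ ()
    ... | suc k | ws =
      let p , vs , pu , _ = unsnoc G ws
          up = adj-sym G pu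
      in p , λ _ → up , cong suc (≤-antisym (shortest vs)
                          (s≤s⁻¹ (subst (_≤ suc (level p)) eq (adj-level pu))))

  parent : Fin n → Fin n
  parent u = proj₁ (∃parent u)

  parent-adj : ∀ {u} → 0 < level u → Adj u (parent u)
  parent-adj 0<u = proj₁ (proj₂ (∃parent _) 0<u)

  parent-level : ∀ {u} → 0 < level u → suc (level (parent u)) ≡ level u
  parent-level 0<u = proj₂ (proj₂ (∃parent _) 0<u)

distances : ∀ {n} (G : Graph n) → Connected G ⊤ → ∀ v → Distances G v
distances G conn v = record
  { level    = λ u → proj₁ (nearest u)
  ; geodesic = λ u → proj₁ (proj₂ (nearest u))
  ; shortest = λ {u} → proj₂ (proj₂ (nearest u))
  }
  where
  Shortest : Fin _ → ℕ → Set
  Shortest u k = Walk G U v u k × (∀ {l} → Walk G U v u l → k ≤ l)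

  -- `fuel` is the gap between the lower bound `k` and the length of a known walk, so the search
  -- ends at that walk at the latest.
  search : ∀ u fuel k → (∀ {l} → Walk G U v u l → k ≤ l) → Walk G U v u (k + fuel) → ∃[ l ] Shortest u l
  search u zero k lower ws = k , subst (Walk G U v u) (+-identityʳ k) ws , lower
  search u (suc fuel) k lower ws with walk? G (λ _ → yes _) v u k
  ... | yes vs = k , vs , lower
  ... | no ¬vs = search u fuel (suc k)
    (λ us → ≤∧≢⇒< (lower us) (λ { refl → ¬vs us }))
    (subst (Walk G U v u) (+-suc k fuel) ws)

  nearest : ∀ u → ∃[ l ] Shortest u l
  nearest u = let k , ws = conn ∈⊤ ∈⊤ in search u k 0 (λ _ → z≤n) (mapWalk G _ ws)

-- Recognising that an induced subgraph is not an odd cycle.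

-- Each index of a cycle has one successor and one predecessor; of three neighbours, two lie on the
-- same side and hence coincide.
cycle-degree : ∀ {n m} {G : Graph n} {S : Subset n} → Iso G S (CycleAdj m) →
               let open Graph G in ∀ {z a b c} → z ∈ S → a ∈ S → b ∈ S → c ∈ S →
               Adj z a → Adj z b → Adj z c → a ≡ b ⊎ a ≡ c ⊎ b ≡ c
cycle-degree {n} {m} {G} {S} iso {z} {a} {b} {c} z∈ a∈ b∈ c∈ za zb zc =
  pigeonhole (side z∈ a∈ za) (side z∈ b∈ zb) (side z∈ c∈ zc)
  where
  open Graph G
  open Iso iso
  index : ∀ {u} → u ∈ S → Fin m
  index u∈ = proj₁ (Equivalence.to (image _) u∈)

  node-index : ∀ {u} (u∈ : u ∈ S) → node (index u∈) ≡ u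
  node-index u∈ = proj₂ (Equivalence.to (image _) u∈)

  Next : Fin m → Fin m → Set
  Next i j = toℕ j ≡ suc (toℕ i) ⊎ (toℕ j ≡ 0 × suc (toℕ i) ≡ m)

  next-unique : ∀ {i j k} → Next i j → Next i k → toℕ j ≡ toℕ k
  next-unique         (inj₁ p)        (inj₁ q)        = trans p (sym q)
  next-unique {j = j} (inj₁ p)        (inj₂ (_ , q))  = ⊥-elim (<-irrefl (trans p q) (toℕ<n j))
  next-unique {k = k} (inj₂ (_ , p))  (inj₁ q)        = ⊥-elim (<-irrefl (trans q p) (toℕ<n k))
  next-unique         (inj₂ (p , _))  (inj₂ (q , _))  = trans p (sym q)

  prev-unique : ∀ {i j k} → Next j i → Next k i → toℕ j ≡ toℕ k
  prev-unique (inj₁ p)       (inj₁ q)       = suc-injective (trans (sym p) q)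
  prev-unique (inj₁ p)       (inj₂ (q , _)) = case trans (sym p) q of λ ()
  prev-unique (inj₂ (p , _)) (inj₁ q)       = case trans (sym p) q of λ ()
  prev-unique (inj₂ (_ , p)) (inj₂ (_ , q)) = suc-injective (trans p (sym q))

  orient : ∀ {i j} → CycleAdj m i j → Next i j ⊎ Next j i
  orient (inj₁ (inj₁ p)) = inj₁ (inj₁ p)
  orient (inj₁ (inj₂ p)) = inj₂ (inj₁ p)
  orient (inj₂ (inj₁ p)) = inj₂ (inj₂ p)
  orient (inj₂ (inj₂ p)) = inj₁ (inj₂ p)

  Side : Fin n → Set
  Side u = ∃[ j ] node j ≡ u × (Next (index z∈) j ⊎ Next j (index z∈))

  side : ∀ {u} → z ∈ S → u ∈ S → Adj z u → Side u
  side _ u∈ zu = index u∈ , node-index u∈ , orient (Equivalence.to (adjacency _ _)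
    (subst₂ Adj (sym (node-index z∈)) (sym (node-index u∈)) zu))

  merge : ∀ {x y i j} → node i ≡ x → node j ≡ y → toℕ i ≡ toℕ j → x ≡ y
  merge ix jy ij = trans (sym ix) (trans (cong node (toℕ-injective ij)) jy)

  pigeonhole : Side a → Side b → Side c → a ≡ b ⊎ a ≡ c ⊎ b ≡ c
  pigeonhole (i , ia , inj₁ p) (j , jb , inj₁ q) _                 = inj₁ (merge ia jb (next-unique p q))
  pigeonhole (i , ia , inj₁ p) (j , jb , inj₂ q) (k , kc , inj₁ s) = inj₂ (inj₁ (merge ia kc (next-unique p s)))
  pigeonhole (i , ia , inj₁ p) (j , jb , inj₂ q) (k , kc , inj₂ s) = inj₂ (inj₂ (merge jb kc (prev-unique q s)))
  pigeonhole (i , ia , inj₂ p) (j , jb , inj₂ q) _                 = inj₁ (merge ia jb (prev-unique p q))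
  pigeonhole (i , ia , inj₂ p) (j , jb , inj₁ q) (k , kc , inj₁ s) = inj₂ (inj₂ (merge jb kc (next-unique q s)))
  pigeonhole (i , ia , inj₂ p) (j , jb , inj₁ q) (k , kc , inj₂ s) = inj₂ (inj₁ (merge ia kc (prev-unique p s)))

Iso⇒∣S∣≡m : ∀ {n m} {G : Graph n} {S : Subset n} {R} → Iso G S {m} R → ∣ S ∣ ≡ m
Iso⇒∣S∣≡m {m = m} {S = S} iso = ≤-antisym
  (covered⇒∣p∣≤ S node (λ {x} x∈ → Equivalence.to (image x) x∈))
  (subst (_≤ ∣ S ∣) (length-tabulate node)
    (Unique⇒length≤∣p∣ S (Uniqueₚ.tabulate⁺ injective)
      (Allₚ.tabulate⁺ (λ i → Equivalence.from (image (node i)) (i , refl)))))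
  where open Iso iso

-- Parent-closed sets and 2-connected sets built from parent chains.

module Layers {n : ℕ} {G : Graph n} {v : Fin n} (D : Distances G v) where
  open Graph G
  open Distances D

  private variable
    S A B : Subset n
    a b x y z u w : Fin n

  Avoiding : Subset n → Fin n → Pred (Fin n) 0ℓ
  Avoiding S x y = y ∈ S × y ≢ x

  record Closed (a : Fin n) (S : Subset n) : Set where
    field
      apex∈ : a ∈ S
      climb : y ∈ S → y ≡ a ⊎ (parent y ∈ S × level a < level y)

    apex≤ : y ∈ S → level a ≤ level y
    apex≤ y∈ with climb y∈
    ... | inj₁ refl      = ≤-refl
    ... | inj₂ (_ , a<y) = <⇒≤ a<y

    fromApex : y ∈ S → Within G (_∈ S) (level y) a y
    fromApex y∈ = go _ y∈ refl
      where
      go : ∀ k {y} → y ∈ S → level y ≡ k → Within G (_∈ S) k a y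
      go k y∈ eq with climb y∈
      ... | inj₁ refl = 0 , z≤n , stop y∈
      go zero    y∈ eq | inj₂ (_ , a<y) = case subst (level a <_) eq a<y of λ ()
      go (suc k) y∈ eq | inj₂ (p∈ , a<y) =
        let 0<y          = ≤-<-trans z≤n a<y
            l , l≤k , ws = go k p∈ (suc-injective (trans (parent-level 0<y) eq))
        in suc l , s≤s l≤k , snoc G ws (adj-sym G (parent-adj 0<y)) y∈

    -- Only the apex may lack its parent in `S`, and it is alone on its level. Applied repeatedly,
    -- this finds ancestors inside a cycle without unfolding how the cycle was built.
    shared-level : y ∈ S → z ∈ S → y ≢ z → level y ≡ level z → parent y ∈ S
    shared-level y∈ z∈ y≢z eq with climb y∈
    ... | inj₂ (p∈ , _) = p∈
    ... | inj₁ refl with climb z∈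
    ...   | inj₁ refl      = ⊥-elim (y≢z refl)
    ...   | inj₂ (_ , a<z) = ⊥-elim (<-irrefl eq a<z)

  Closed-∪ : Closed a A → Closed b B → x ∈ A → x ∈ B → level a ≤ level b → Closed a (A ∪ B)
  Closed-∪ {a} {A} {b} {B} cA cB x∈A x∈B a≤b = record
    { apex∈ = p⊆p∪q B A.apex∈
    ; climb = λ y∈ → [ fromA , fromB ]′ (x∈p∪q⁻ A B y∈)
    }
    where
    module A = Closed cA
    module B = Closed cB

    fromA : ∀ {y} → y ∈ A → y ≡ a ⊎ (parent y ∈ A ∪ B × level a < level y)
    fromA y∈ with A.climb y∈
    ... | inj₁ eq        = inj₁ eq
    ... | inj₂ (p∈ , lt) = inj₂ (p⊆p∪q B p∈ , lt)

    -- The parents of x stay in A ∩ B until they reach b.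
    b∈A : ∀ k {y} → y ∈ A → y ∈ B → level y ≡ k → b ∈ A
    b∈A k y∈A y∈B eq with B.climb y∈B
    ... | inj₁ refl = y∈A
    ... | inj₂ (p∈B , b<y) with A.climb y∈A
    ...   | inj₁ refl = ⊥-elim (<-irrefl refl (<-≤-trans b<y a≤b))
    b∈A zero    y∈A y∈B eq | inj₂ (p∈B , b<y) | inj₂ _ = case subst (level b <_) eq b<y of λ ()
    b∈A (suc k) y∈A y∈B eq | inj₂ (p∈B , b<y) | inj₂ (p∈A , _) =
      b∈A k p∈A p∈B (suc-injective (trans (parent-level (≤-<-trans z≤n b<y)) eq))

    fromB : ∀ {y} → y ∈ B → y ≡ a ⊎ (parent y ∈ A ∪ B × level a < level y)
    fromB y∈ with B.climb y∈
    ... | inj₁ refl       = fromA (b∈A _ x∈A x∈B refl)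
    ... | inj₂ (p∈ , b<y) = inj₂ (q⊆p∪q A B p∈ , ≤-<-trans a≤b b<y)

  -- The two parent chains from u and from w up to their first common node.
  record Ear (u w : Fin n) (S : Subset n) : Set where
    field
      left∈     : u ∈ S
      right∈    : w ∈ S
      top       : y ∈ S → level y ≤ level u
      connected : Connected G S
      escape    : y ∈ S → y ≢ x → Linked G (Avoiding S x) y u ⊎ Linked G (Avoiding S x) y w
      odd       : ∃[ k ] ∣ S ∣ ≡ suc (k * 2)
      apex      : Fin n
      closed    : Closed apex S

  connected-∪⁅⁆ : Connected G S → z ∈ S → Adj x z → Connected G (S ∪ ⁅ x ⁆)
  connected-∪⁅⁆ {S} {z} {x} conn z∈ xz u∈ w∈ = linked-trans G (toZ u∈) (linked-sym G (toZ w∈))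
    where
    toZ : ∀ {y} → y ∈ S ∪ ⁅ x ⁆ → Linked G (_∈ S ∪ ⁅ x ⁆) y z
    toZ y∈ with x∈p∪⁅y⁆⁻ S x y∈
    ... | inj₁ y∈S  = linked-map G (p⊆p∪q ⁅ x ⁆) (conn y∈S z∈)
    ... | inj₂ refl = linked-snoc G (linked-refl G y∈) xz (p⊆p∪q ⁅ x ⁆ z∈)

  trivial-ear : ∀ u → Ear u u ⁅ u ⁆
  trivial-ear u = record
    { left∈     = x∈⁅x⁆ u
    ; right∈    = x∈⁅x⁆ u
    ; top       = λ y∈ → ≤-reflexive (cong level (x∈⁅y⁆⇒x≡y u y∈))
    ; connected = λ y∈ z∈ → subst₂ (Linked G (_∈ ⁅ u ⁆)) (sym (x∈⁅y⁆⇒x≡y u y∈)) (sym (x∈⁅y⁆⇒x≡y u z∈))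
                              (linked-refl G (x∈⁅x⁆ u))
    ; escape    = λ {y} {x} y∈ y≢x → inj₁ (subst (Linked G (Avoiding ⁅ u ⁆ x) y) (x∈⁅y⁆⇒x≡y u y∈)
                                            (linked-refl G (y∈ , y≢x)))
    ; odd       = 0 , ∣⁅x⁆∣≡1 u
    ; apex      = u
    ; closed    = record { apex∈ = x∈⁅x⁆ u ; climb = λ y∈ → inj₁ (x∈⁅y⁆⇒x≡y u y∈) }
    }

  extend-ear : u ≢ w → level u ≡ level w → 0 < level u →
               Ear (parent u) (parent w) S → Ear u w ((S ∪ ⁅ u ⁆) ∪ ⁅ w ⁆)
  extend-ear {u} {w} {S} u≢w u~w 0<u E = record
    { left∈     = u∈
    ; right∈    = w∈
    ; top       = λ y∈ → case split y∈ of λ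
        { (inj₁ y∈S)         → <⇒≤ (below y∈S)
        ; (inj₂ (inj₁ refl)) → ≤-refl
        ; (inj₂ (inj₂ refl)) → ≤-reflexive (sym u~w) }
    ; connected = connected-∪⁅⁆ (connected-∪⁅⁆ E.connected E.left∈ (parent-adj 0<u))
                    (p⊆p∪q ⁅ u ⁆ E.right∈) (parent-adj 0<w)
    ; escape    = escape′
    ; odd       = let k , eq = E.odd in suc k ,
        trans (∣p∪⁅x⁆∣≡1+∣p∣ (S ∪ ⁅ u ⁆) w w∉) (cong suc
          (trans (∣p∪⁅x⁆∣≡1+∣p∣ S u u∉S) (cong suc eq)))
    ; apex      = E.apex
    ; closed    = record
        { apex∈ = S⊆ (Closed.apex∈ E.closed)
        ; climb = λ y∈ → case split y∈ of λ
          { (inj₁ y∈S) → case Closed.climb E.closed y∈S of λ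
              { (inj₁ eq)        → inj₁ eq
              ; (inj₂ (p∈ , lt)) → inj₂ (S⊆ p∈ , lt) }
          ; (inj₂ (inj₁ refl)) → inj₂ (S⊆ E.left∈ , below (Closed.apex∈ E.closed))
          ; (inj₂ (inj₂ refl)) → inj₂ (S⊆ E.right∈ , subst (level E.apex <_) u~w (below (Closed.apex∈ E.closed))) } }
    }
    where
    module E = Ear E
    S⁺ = (S ∪ ⁅ u ⁆) ∪ ⁅ w ⁆

    0<w : 0 < level w
    0<w = subst (0 <_) u~w 0<u

    S⊆ : ∀ {y} → y ∈ S → y ∈ S⁺
    S⊆ y∈ = p⊆p∪q ⁅ w ⁆ (p⊆p∪q ⁅ u ⁆ y∈)

    u∈ : u ∈ S⁺
    u∈ = p⊆p∪q ⁅ w ⁆ (x∈p∪⁅x⁆ S u)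

    w∈ : w ∈ S⁺
    w∈ = x∈p∪⁅x⁆ (S ∪ ⁅ u ⁆) w

    below : ∀ {y} → y ∈ S → level y < level u
    below y∈ = subst (level _ <_) (parent-level 0<u) (s≤s (E.top y∈))

    u∉S : u ∉ S
    u∉S u∈S = <-irrefl refl (below u∈S)

    w∉S : w ∉ S
    w∉S w∈S = <-irrefl (sym u~w) (below w∈S)

    w∉ : w ∉ S ∪ ⁅ u ⁆
    w∉ h with x∈p∪⁅y⁆⁻ S u h
    ... | inj₁ w∈S  = w∉S w∈S
    ... | inj₂ refl = u≢w refl

    split : ∀ {y} → y ∈ S⁺ → y ∈ S ⊎ (y ≡ u ⊎ y ≡ w)
    split y∈ with x∈p∪⁅y⁆⁻ (S ∪ ⁅ u ⁆) w y∈
    ... | inj₂ eq = inj₂ (inj₂ eq)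
    ... | inj₁ h with x∈p∪⁅y⁆⁻ S u h
    ...   | inj₁ y∈S = inj₁ y∈S
    ...   | inj₂ eq  = inj₂ (inj₁ eq)

    grow : ∀ {x y z} → Linked G (Avoiding S x) y z → Linked G (Avoiding S⁺ x) y z
    grow = linked-map G (λ (h , ne) → S⊆ h , ne)

    around : ∀ {x y z} → x ∉ S → y ∈ S → z ∈ S → Linked G (Avoiding S⁺ x) y z
    around x∉ y∈ z∈ = linked-map G (λ h → S⊆ h , λ { refl → x∉ h }) (E.connected y∈ z∈)

    -- If the deleted node is one of the new ends, the old ear is intact and connected and can be
    -- left through the other end. Otherwise the old ear already escapes to one of its ends, and one
    -- edge down leads to a new end.
    escape′ : ∀ {y x} → y ∈ S⁺ → y ≢ x → Linked G (Avoiding S⁺ x) y u ⊎ Linked G (Avoiding S⁺ x) y w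
    escape′ {y} {x} y∈ y≢x with split y∈
    ... | inj₂ (inj₁ refl) = inj₁ (linked-refl G (y∈ , y≢x))
    ... | inj₂ (inj₂ refl) = inj₂ (linked-refl G (y∈ , y≢x))
    ... | inj₁ y∈S with u ≟ᶠ x | w ≟ᶠ x
    ...   | yes refl | _        = inj₂ (linked-snoc G (around u∉S y∈S E.right∈)
                                    (adj-sym G (parent-adj 0<w)) (w∈ , u≢w ∘ sym))
    ...   | no u≢x   | yes refl = inj₁ (linked-snoc G (around w∉S y∈S E.left∈)
                                    (adj-sym G (parent-adj 0<u)) (u∈ , u≢w))
    ...   | no u≢x   | no w≢x   with E.escape y∈S y≢x
    ...     | inj₁ ws = inj₁ (linked-snoc G (grow ws) (adj-sym G (parent-adj 0<u)) (u∈ , u≢x))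
    ...     | inj₂ ws = inj₂ (linked-snoc G (grow ws) (adj-sym G (parent-adj 0<w)) (w∈ , w≢x))

  ear : ∀ u w → level u ≡ level w → ∃[ S ] Ear u w S
  ear u w u~w = go (level u) refl (sym u~w)
    where
    go : ∀ k {u w} → level u ≡ k → level w ≡ k → ∃[ S ] Ear u w S
    go k {u} {w} eu ew with u ≟ᶠ w
    ... | yes refl = _ , trivial-ear u
    go zero eu ew | no u≢w = ⊥-elim (u≢w (trans (level≡0⇒source eu) (sym (level≡0⇒source ew))))
    go (suc k) eu ew | no u≢w =
      let 0<u = subst (0 <_) (sym eu) z<s
          0<w = subst (0 <_) (sym ew) z<s
          S , E = go k (suc-injective (trans (parent-level 0<u) eu)) (suc-injective (trans (parent-level 0<w) ew))
      in _ , extend-ear u≢w (trans eu (sym ew)) 0<u E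

  record Block (S : Subset n) : Set where
    field
      apex        : Fin n
      closed      : Closed apex S
      connected   : Connected G S
      biconnected : y ∈ S → z ∈ S → y ≢ x → z ≢ x → Linked G (Avoiding S x) y z

    open Closed closed public

  last : ∀ {P : Pred (Fin n) 0ℓ} {u w} → Linked G P u w → P w
  last (_ , ws) = head G (reverse G ws)

  -- After a deletion every remaining node still reaches `u` or `w`. If two nodes reach different
  -- ends, both ends have survived and the edge between them joins the walks.
  cycle-block : Ear u w S → Adj u w → Block S
  cycle-block {u} {w} {S} E uw = record
    { apex = apex ; closed = closed ; connected = connected
    ; biconnected = λ y∈ z∈ y≢x z≢x → case (escape y∈ y≢x , escape z∈ z≢x) of λ
      { (inj₁ ys , inj₁ zs) → linked-trans G ys (linked-sym G zs)
      ; (inj₂ ys , inj₂ zs) → linked-trans G ys (linked-sym G zs)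
      ; (inj₁ ys , inj₂ zs) → linked-trans G (linked-snoc G ys uw (last zs)) (linked-sym G zs)
      ; (inj₂ ys , inj₁ zs) → linked-trans G (linked-snoc G ys (adj-sym G uw) (last zs)) (linked-sym G zs) }
    }
    where open Ear E

  -- Here `x` closes the ear from below. Deleting `x` leaves the connected ear; after deleting any
  -- other node, whatever escapes to an end of the ear continues to `x`.
  even-block : Ear (parent x) w S → x ∉ S → 0 < level x → Adj x w → Block (S ∪ ⁅ x ⁆)
  even-block {x} {w} {S} E x∉S 0<x xw = record
    { apex = apex
    ; closed = record
      { apex∈ = p⊆p∪q ⁅ x ⁆ (Closed.apex∈ closed)
      ; climb = λ y∈ → case x∈p∪⁅y⁆⁻ S x y∈ of λ
        { (inj₁ y∈S) → case Closed.climb closed y∈S of λ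
            { (inj₁ eq)        → inj₁ eq
            ; (inj₂ (p∈ , lt)) → inj₂ (p⊆p∪q ⁅ x ⁆ p∈ , lt) }
        ; (inj₂ refl) → inj₂ (p⊆p∪q ⁅ x ⁆ left∈ ,
            subst (level apex <_) (parent-level 0<x) (s≤s (Closed.apex≤ closed left∈))) } }
    ; connected = connected-∪⁅⁆ connected left∈ (parent-adj 0<x)
    ; biconnected = bi
    }
    where
    open Ear E
    S⁺ = S ∪ ⁅ x ⁆

    toX : ∀ {t y} → t ≢ x → y ∈ S⁺ → y ≢ t → Linked G (Avoiding S⁺ t) y x
    toX t≢x y∈ y≢t with x∈p∪⁅y⁆⁻ S x y∈
    ... | inj₂ refl = linked-refl G (y∈ , y≢t)
    ... | inj₁ y∈S with escape y∈S y≢t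
    ...   | inj₁ ws = linked-snoc G (linked-map G (λ (h , ne) → p⊆p∪q ⁅ x ⁆ h , ne) ws)
                        (adj-sym G (parent-adj 0<x)) (x∈p∪⁅x⁆ S x , t≢x ∘ sym)
    ...   | inj₂ ws = linked-snoc G (linked-map G (λ (h , ne) → p⊆p∪q ⁅ x ⁆ h , ne) ws)
                        (adj-sym G xw) (x∈p∪⁅x⁆ S x , t≢x ∘ sym)

    bi : ∀ {y z t} → y ∈ S⁺ → z ∈ S⁺ → y ≢ t → z ≢ t → Linked G (Avoiding S⁺ t) y z
    bi {t = t} y∈ z∈ y≢t z≢t with t ≟ᶠ x
    ... | no t≢x = linked-trans G (toX t≢x y∈ y≢t) (linked-sym G (toX t≢x z∈ z≢t))
    ... | yes refl with x∈p∪⁅y⁆⁻ S x y∈ | x∈p∪⁅y⁆⁻ S x z∈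
    ...   | inj₂ eq  | _        = ⊥-elim (y≢t eq)
    ...   | inj₁ _   | inj₂ eq  = ⊥-elim (z≢t eq)
    ...   | inj₁ y∈S | inj₁ z∈S =
      linked-map G (λ h → p⊆p∪q ⁅ x ⁆ h , λ { refl → x∉S h }) (connected y∈S z∈S)

  -- A deletion removes at most one of the two common nodes; the other one still holds `A` and `B`
  -- together.
  Block-∪ : Block A → Block B → x ≢ y → x ∈ A → x ∈ B → y ∈ A → y ∈ B → Block (A ∪ B)
  Block-∪ {A} {B} {x} {y} bA bB x≢y x∈A x∈B y∈A y∈B = record
    { apex = proj₁ ∃apex
    ; closed = proj₂ ∃apex
    ; connected = λ s∈ t∈ → linked-trans G (toX s∈) (linked-sym G (toX t∈))
    ; biconnected = bi
    }
    where
    module A = Block bA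
    module B = Block bB

    ∃apex : ∃[ a ] Closed a (A ∪ B)
    ∃apex with ≤-total (level A.apex) (level B.apex)
    ... | inj₁ le = _ , Closed-∪ A.closed B.closed x∈A x∈B le
    ... | inj₂ ge = _ , subst (Closed B.apex) (∪-comm B A) (Closed-∪ B.closed A.closed x∈B x∈A ge)

    toX : ∀ {s} → s ∈ A ∪ B → Linked G (_∈ A ∪ B) s x
    toX s∈ with x∈p∪q⁻ A B s∈
    ... | inj₁ s∈A = linked-map G (p⊆p∪q B) (A.connected s∈A x∈A)
    ... | inj₂ s∈B = linked-map G (q⊆p∪q A B) (B.connected s∈B x∈B)

    toCommon : ∀ {s t c} → c ∈ A → c ∈ B → s ∈ A ∪ B → s ≢ t → c ≢ t → Linked G (Avoiding (A ∪ B) t) s c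
    toCommon c∈A c∈B s∈ s≢t c≢t with x∈p∪q⁻ A B s∈
    ... | inj₁ s∈A = linked-map G (λ (h , ne) → p⊆p∪q B h , ne) (A.biconnected s∈A c∈A s≢t c≢t)
    ... | inj₂ s∈B = linked-map G (λ (h , ne) → q⊆p∪q A B h , ne) (B.biconnected s∈B c∈B s≢t c≢t)

    bi : ∀ {s s′ t} → s ∈ A ∪ B → s′ ∈ A ∪ B → s ≢ t → s′ ≢ t → Linked G (Avoiding (A ∪ B) t) s s′
    bi {t = t} s∈ s′∈ s≢t s′≢t with x ≟ᶠ t
    ... | no x≢t = linked-trans G (toCommon x∈A x∈B s∈ s≢t x≢t)
                     (linked-sym G (toCommon x∈A x∈B s′∈ s′≢t x≢t))
    ... | yes refl = linked-trans G (toCommon y∈A y∈B s∈ s≢t (x≢y ∘ sym))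
                     (linked-sym G (toCommon y∈A y∈B s′∈ s′≢t (x≢y ∘ sym)))

-- Local structure of the layers in the absence of small degree-choosable components.

record Sparse {n : ℕ} (G : Graph n) (v : Fin n) (r : ℕ) : Set where
  open Graph G
  field
    distance  : Distances G v
    connected : Connected G ⊤
    notClique : ¬ Clique G ⊤
    deg≤3     : ∀ u → deg u ≤ 3
    deg≡3     : ∀ u → Distances.level distance u ≤ r → deg u ≡ 3
    noDCC     : ¬ (∃[ S ] DCC G S × RadiusAtMost G r S)

module Structure {n : ℕ} {G : Graph n} {v : Fin n} {r : ℕ} (sparse : Sparse G v r) where
  open Graph G
  open Sparse sparse using (notClique; deg≤3; deg≡3; noDCC)
  open Distances (Sparse.distance sparse)
  open Layers (Sparse.distance sparse)

  private variable
    S A B : Subset n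
    a b c d s x y z u w : Fin n

  Child : Fin n → Fin n → Set
  Child u c = Adj u c × level c ≡ suc (level u)

  Horizontal : Fin n → Fin n → Set
  Horizontal u w = Adj u w × level u ≡ level w

  Two : Fin n → Set
  Two u = ∃[ a ] ∃[ b ] a ≢ b × Child u a × Child u b

  One : Fin n → Set
  One u = ∃[ q ] ∃[ c ] Horizontal u q × Child u c × (∀ {z} → Child u z → z ≡ c)

  Horizontal-sym : Horizontal u w → Horizontal w u
  Horizontal-sym (uw , eq) = adj-sym G uw , sym eq

  level<⇒≢ : level u < level w → u ≢ w
  level<⇒≢ u<w refl = <-irrefl refl u<w

  level>⇒≢ : level w < level u → u ≢ w
  level>⇒≢ w<u refl = <-irrefl refl w<u

  level-pos : u ≢ w → level u ≡ level w → 0 < level u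
  level-pos {u} {w} u≢w eq with level u in eu
  ... | zero  = ⊥-elim (u≢w (trans (level≡0⇒source eu) (sym (level≡0⇒source (sym eq)))))
  ... | suc _ = z<s

  Horizontal-pos : Horizontal u w → 0 < level u
  Horizontal-pos (uw , eq) = level-pos (Adj⇒≢ G uw) eq

  Bounded : Subset n → Set
  Bounded S = ∀ {y} → y ∈ S → level y ≤ r

  no-block : Block S → Bounded S → 3 ≤ ∣ S ∣ → ¬ Clique G S → ¬ IsOddCycle G S → ⊥ᵗ
  no-block {S} block bounded 3≤ ¬clique ¬odd = noDCC (S , (two , ¬clique , ¬odd) ,
      apex , apex∈ , λ y∈ → within-≤ G (bounded y∈) (fromApex y∈))
    where
    open Block block
    two : TwoConnected G S
    two = 3≤ , connected , λ {x} x∈ u∈ w∈ →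
      let u∈S , u≢x = x∈p-y⁻ S _ x u∈
          w∈S , w≢x = x∈p-y⁻ S _ x w∈
      in linked-map G (λ (h , ne) → x∈p∧x≢y⇒x∈p-y h ne) (biconnected u∈S w∈S u≢x w≢x)

  three-in : x ∈ S → y ∈ S → z ∈ S → x ≢ y → x ≢ z → y ≢ z → 3 ≤ ∣ S ∣
  three-in x∈ y∈ z∈ x≢y x≢z y≢z = Unique⇒length≤∣p∣ _
    ((x≢y ∷ x≢z ∷ []) ∷ (y≢z ∷ []) ∷ [] ∷ []) (x∈ ∷ y∈ ∷ z∈ ∷ [])

  no-four-neighbours : Adj z a → Adj z b → Adj z c → Adj z d →
                       a ≢ b → a ≢ c → a ≢ d → b ≢ c → b ≢ d → c ≢ d → ⊥ᵗ
  no-four-neighbours {z} za zb zc zd ab ac ad bc bd cd = <-irrefl refl (≤-trans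
    (Unique⇒length≤∣p∣ (nbhd z)
      ((ab ∷ ac ∷ ad ∷ []) ∷ (bc ∷ bd ∷ []) ∷ (cd ∷ []) ∷ [] ∷ []) (za ∷ zb ∷ zc ∷ zd ∷ []))
    (deg≤3 z))

  -- The union is 2-connected. It is not a cycle, as `z` has three neighbours in it, and not a
  -- clique, as these three do not form a triangle. All contradictions between two overlapping
  -- cycles go through this lemma.
  no-common-edge : Block A → Bounded A → Block B → Bounded B →
                   x ≢ y → x ∈ A → x ∈ B → y ∈ A → y ∈ B →
                   z ∈ A ∪ B → a ∈ A ∪ B → b ∈ A ∪ B → c ∈ A ∪ B →
                   Adj z a → Adj z b → Adj z c → a ≢ b → a ≢ c → b ≢ c →
                   ¬ (Adj a b × Adj a c × Adj b c) → ⊥ᵗ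
  no-common-edge {A} {B} blockA boundA blockB boundB x≢y x∈A x∈B y∈A y∈B z∈ a∈ b∈ c∈ za zb zc a≢b a≢c b≢c ¬triangle =
    no-block (Block-∪ blockA blockB x≢y x∈A x∈B y∈A y∈B)
      (λ h → [ boundA , boundB ]′ (x∈p∪q⁻ A B h))
      (three-in a∈ b∈ c∈ a≢b a≢c b≢c)
      (λ clique → ¬triangle (clique a∈ b∈ a≢b , clique a∈ c∈ a≢c , clique b∈ c∈ b≢c))
      (λ (m , _ , _ , iso) → case cycle-degree {G = G} iso z∈ a∈ b∈ c∈ za zb zc of λ
        { (inj₁ eq) → a≢b eq ; (inj₂ (inj₁ eq)) → a≢c eq ; (inj₂ (inj₂ eq)) → b≢c eq })

  cycle : Horizontal u w → level u ≤ r → ∃[ S ] Block S × Bounded S × u ∈ S × w ∈ S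
  cycle {u} {w} (uw , eq) u≤r =
    let S , E = ear u w eq
    in S , cycle-block E uw , (λ y∈ → ≤-trans (Ear.top E y∈) u≤r) , Ear.left∈ E , Ear.right∈ E

  level-parent< : 0 < level u → level (parent u) < level u
  level-parent< 0<u = subst (level (parent _) <_) (parent-level 0<u) ≤-refl

  level-parent≡ : 0 < level u → 0 < level w → level u ≡ level w → level (parent u) ≡ level (parent w)
  level-parent≡ 0<u 0<w eq = suc-injective (trans (parent-level 0<u) (trans eq (sym (parent-level 0<w))))

  Child-parent : 0 < level u → Child (parent u) u
  Child-parent 0<u = adj-sym G (parent-adj 0<u) , sym (parent-level 0<u)

  -- A second neighbour one level up would close an even cycle through `c`. This cycle is not a
  -- clique: it contains the grandparent of `c`, which is two levels away from `c`.
  unique-parent : Child u c → level c ≤ r → u ≡ parent c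
  unique-parent {u} {c} (uc , lc) c≤r with u ≟ᶠ parent c
  ... | yes eq = eq
  ... | no u≢p = ⊥-elim (no-block (even-block E c∉S 0<c (adj-sym G uc)) bounded
      (three-in c∈ (S⊆ left∈) (S⊆ right∈) (Adj⇒≢ G (parent-adj 0<c)) (Adj⇒≢ G (adj-sym G uc)) (u≢p ∘ sym))
      (λ clique → c≁pp (clique c∈ (S⊆ pp∈) (level>⇒≢ (<-trans (level-parent< 0<p) (level-parent< 0<c)))))
      (λ (m , _ , odd-m , iso) → odd-m (subst (2 ∣_) (Iso⇒∣S∣≡m {G = G} iso) 2∣)))
    where
    0<c : 0 < level c
    0<c = subst (0 <_) (sym lc) z<s

    p~u : level (parent c) ≡ level u
    p~u = suc-injective (trans (parent-level 0<c) lc)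

    0<p : 0 < level (parent c)
    0<p = level-pos (u≢p ∘ sym) p~u

    ∃E = ear (parent c) u p~u
    T  = proj₁ ∃E
    E  = proj₂ ∃E
    open Ear E

    S⊆ : ∀ {y} → y ∈ T → y ∈ T ∪ ⁅ c ⁆
    S⊆ = p⊆p∪q ⁅ c ⁆

    c∈ : c ∈ T ∪ ⁅ c ⁆
    c∈ = x∈p∪⁅x⁆ T c

    c∉S : c ∉ T
    c∉S h = <-irrefl refl (<-≤-trans (level-parent< 0<c) (top h))

    pp∈ : parent (parent c) ∈ T
    pp∈ = Closed.shared-level closed left∈ right∈ (u≢p ∘ sym) p~u

    c≁pp : ¬ Adj c (parent (parent c))
    c≁pp h = <-irrefl refl (≤-trans
      (≤-trans (s≤s (level-parent< 0<p)) (level-parent< 0<c))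
      (adj-level (adj-sym G h)))

    bounded : Bounded (T ∪ ⁅ c ⁆)
    bounded h with x∈p∪⁅y⁆⁻ T c h
    ... | inj₁ y∈S  = ≤-trans (top y∈S) (≤-trans (<⇒≤ (level-parent< 0<c)) c≤r)
    ... | inj₂ refl = c≤r

    2∣ : 2 ∣ ∣ T ∪ ⁅ c ⁆ ∣
    2∣ = let k , eq = odd in divides (suc k) (trans (∣p∪⁅x⁆∣≡1+∣p∣ T c c∉S) (cong suc eq))

  -- In a K₄ all four nodes have exhausted their degree, so by connectivity it would be the whole
  -- graph, which is not a clique. This removes the case in which overlapping cycles form a clique
  -- rather than a degree-choosable component.
  no-K₄ : Adj u a → Adj u b → Adj u c → Adj a b → Adj a c → Adj b c → ⊥ᵗ
  no-K₄ {u} {a} {b} {c} ua ub uc ab ac bc = notClique clique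
    where
    K : Pred (Fin n) 0ℓ
    K x = x ≡ u ⊎ x ≡ a ⊎ x ≡ b ⊎ x ≡ c

    flip : ∀ {x y} → Adj x y → Adj y x
    flip = adj-sym G

    fourth : ∀ {x p q s y} → Adj x p → Adj x q → Adj x s → Adj p q → Adj p s → Adj q s →
             Adj x y → y ≡ p ⊎ y ≡ q ⊎ y ≡ s
    fourth {x} {p} {q} {s} {y} xp xq xs pq ps qs xy with y ≟ᶠ p | y ≟ᶠ q | y ≟ᶠ s
    ... | yes e | _     | _     = inj₁ e
    ... | no _  | yes e | _     = inj₂ (inj₁ e)
    ... | no _  | no _  | yes e = inj₂ (inj₂ e)
    ... | no y≢p | no y≢q | no y≢s = ⊥-elim (no-four-neighbours xp xq xs xy
      (Adj⇒≢ G pq) (Adj⇒≢ G ps) (y≢p ∘ sym) (Adj⇒≢ G qs) (y≢q ∘ sym) (y≢s ∘ sym))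

    closed : ∀ {x y} → K x → Adj x y → K y
    closed (inj₁ refl) xy = case fourth ua ub uc ab ac bc xy of λ
      { (inj₁ e) → inj₂ (inj₁ e) ; (inj₂ (inj₁ e)) → inj₂ (inj₂ (inj₁ e)) ; (inj₂ (inj₂ e)) → inj₂ (inj₂ (inj₂ e)) }
    closed (inj₂ (inj₁ refl)) xy = case fourth (flip ua) ab ac ub uc bc xy of λ
      { (inj₁ e) → inj₁ e ; (inj₂ (inj₁ e)) → inj₂ (inj₂ (inj₁ e)) ; (inj₂ (inj₂ e)) → inj₂ (inj₂ (inj₂ e)) }
    closed (inj₂ (inj₂ (inj₁ refl))) xy = case fourth (flip ub) (flip ab) bc ua uc ac xy of λ
      { (inj₁ e) → inj₁ e ; (inj₂ (inj₁ e)) → inj₂ (inj₁ e) ; (inj₂ (inj₂ e)) → inj₂ (inj₂ (inj₂ e)) }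
    closed (inj₂ (inj₂ (inj₂ refl))) xy = case fourth (flip uc) (flip ac) (flip bc) ua ub ab xy of λ
      { (inj₁ e) → inj₁ e ; (inj₂ (inj₁ e)) → inj₂ (inj₁ e) ; (inj₂ (inj₂ e)) → inj₂ (inj₂ (inj₁ e)) }

    stays : ∀ {P x y k} → Walk G P x y k → K x → K y
    stays (stop _)      Kx = Kx
    stays (step _ e ws) Kx = stays ws (closed Kx e)

    all-K : ∀ y → K y
    all-K y = stays (proj₂ (Sparse.connected sparse ∈⊤ ∈⊤)) (inj₁ {B = u ≡ a ⊎ u ≡ b ⊎ u ≡ c} refl)

    clique : Clique G ⊤
    clique {x} {y} _ _ x≢y with all-K x | all-K y
    ... | inj₁ refl               | inj₁ refl               = ⊥-elim (x≢y refl)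
    ... | inj₁ refl               | inj₂ (inj₁ refl)        = ua
    ... | inj₁ refl               | inj₂ (inj₂ (inj₁ refl)) = ub
    ... | inj₁ refl               | inj₂ (inj₂ (inj₂ refl)) = uc
    ... | inj₂ (inj₁ refl)        | inj₁ refl               = flip ua
    ... | inj₂ (inj₁ refl)        | inj₂ (inj₁ refl)        = ⊥-elim (x≢y refl)
    ... | inj₂ (inj₁ refl)        | inj₂ (inj₂ (inj₁ refl)) = ab
    ... | inj₂ (inj₁ refl)        | inj₂ (inj₂ (inj₂ refl)) = ac
    ... | inj₂ (inj₂ (inj₁ refl)) | inj₁ refl               = flip ub
    ... | inj₂ (inj₂ (inj₁ refl)) | inj₂ (inj₁ refl)        = flip ab
    ... | inj₂ (inj₂ (inj₁ refl)) | inj₂ (inj₂ (inj₁ refl)) = ⊥-elim (x≢y refl)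
    ... | inj₂ (inj₂ (inj₁ refl)) | inj₂ (inj₂ (inj₂ refl)) = bc
    ... | inj₂ (inj₂ (inj₂ refl)) | inj₁ refl               = flip uc
    ... | inj₂ (inj₂ (inj₂ refl)) | inj₂ (inj₁ refl)        = flip ac
    ... | inj₂ (inj₂ (inj₂ refl)) | inj₂ (inj₂ (inj₁ refl)) = flip bc
    ... | inj₂ (inj₂ (inj₂ refl)) | inj₂ (inj₂ (inj₂ refl)) = ⊥-elim (x≢y refl)

  -- The cycles closed by the two edges share `u` and its parent, and in their union `u` has the
  -- neighbours `a`, `b` and `parent u`. If those formed a triangle, they would make a K₄ with `u`.
  unique-horizontal : Horizontal u a → Horizontal u b → level u ≤ r → a ≡ b
  unique-horizontal {u} {a} {b} ha hb u≤r with a ≟ᶠ b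
  ... | yes eq = eq
  ... | no a≢b =
    let 0<u = Horizontal-pos ha
        A , blockA , boundA , u∈A , a∈A = cycle ha u≤r
        B , blockB , boundB , u∈B , b∈B = cycle hb u≤r
        p∈A = Block.shared-level blockA u∈A a∈A (Adj⇒≢ G (proj₁ ha)) (proj₂ ha)
        p∈B = Block.shared-level blockB u∈B b∈B (Adj⇒≢ G (proj₁ hb)) (proj₂ hb)
        p<u = level-parent< 0<u
    in ⊥-elim (no-common-edge blockA boundA blockB boundB (Adj⇒≢ G (parent-adj 0<u)) u∈A u∈B p∈A p∈B
         (p⊆p∪q B u∈A) (p⊆p∪q B a∈A) (q⊆p∪q A B b∈B) (p⊆p∪q B p∈A)
         (proj₁ ha) (proj₁ hb) (parent-adj 0<u) a≢b
         (level>⇒≢ (<-≤-trans p<u (≤-reflexive (proj₂ ha))))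
         (level>⇒≢ (<-≤-trans p<u (≤-reflexive (proj₂ hb))))
         (λ (ab , ap , bp) → no-K₄ (proj₁ ha) (proj₁ hb) (parent-adj 0<u) ab ap bp))

  -- The case of two cycles sharing the edge from `y` to its parent. No triangle arises, because the
  -- child `a` is two levels below that parent.
  no-common-parent-edge : Block A → Bounded A → Block B → Bounded B → 0 < level y →
    y ∈ A → y ∈ B → parent y ∈ A → parent y ∈ B → a ∈ A → b ∈ B →
    Child y a → Adj y b → level y ≤ level b → a ≢ b → ⊥ᵗ
  no-common-parent-edge {A} {B} {y} blockA boundA blockB boundB 0<y y∈A y∈B p∈A p∈B a∈A b∈B (ya , la) yb y≤b a≢b =
    no-common-edge blockA boundA blockB boundB (Adj⇒≢ G (parent-adj 0<y)) y∈A y∈B p∈A p∈B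
      (p⊆p∪q B y∈A) (p⊆p∪q B a∈A) (q⊆p∪q A B b∈B) (p⊆p∪q B p∈A)
      ya yb (parent-adj 0<y) a≢b
      (level>⇒≢ (<-trans (level-parent< 0<y) (subst (level y <_) (sym la) ≤-refl)))
      (level>⇒≢ (<-≤-trans (level-parent< 0<y) y≤b))
      (λ (_ , ap , _) → <-irrefl refl (≤-trans
        (subst (λ k → suc (level (parent y)) < k) (sym la) (s≤s (level-parent< 0<y)))
        (adj-level (adj-sym G ap))))

  -- If `c` and `a` have the same parent `u`, then `u` has four neighbours. Otherwise the cycle
  -- closed by the edge from `c` to `a` climbs through `u` to the parent of `u`, and so shares an
  -- edge with the cycle of `u` and `b`.
  child-horizontal : Child u c → Horizontal u b → Horizontal c a → level c ≤ r → ⊥ᵗ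
  child-horizontal {u} {c} {b} {a} (uc , lc) ub ca c≤r
    with unique-parent (uc , lc) c≤r
  ... | refl = go (parent c ≟ᶠ parent a)
    where
    0<u = Horizontal-pos ub
    0<c = Horizontal-pos ca
    0<a = Horizontal-pos (Horizontal-sym ca)

    u<c : level (parent c) < level c
    u<c = level-parent< 0<c

    u<a : level (parent c) < level a
    u<a = <-≤-trans u<c (≤-reflexive (proj₂ ca))

    p<u : level (parent (parent c)) < level (parent c)
    p<u = level-parent< 0<u

    go : Dec (parent c ≡ parent a) → ⊥ᵗ
    go (yes eq) = no-four-neighbours uc (subst (λ p → Adj p a) (sym eq) (proj₁ (Child-parent 0<a)))
      (proj₁ ub) (parent-adj 0<u)
      (Adj⇒≢ G (proj₁ ca))
      (level>⇒≢ (<-≤-trans (s≤s (≤-reflexive (sym (proj₂ ub)))) u<c))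
      (level>⇒≢ (<-trans p<u u<c))
      (level>⇒≢ (<-≤-trans (s≤s (≤-reflexive (sym (proj₂ ub)))) u<a))
      (level>⇒≢ (<-trans p<u u<a))
      (level>⇒≢ (<-≤-trans p<u (≤-reflexive (proj₂ ub))))
    go (no p≢p) =
      let A , blockA , boundA , c∈A , a∈A = cycle ca c≤r
          B , blockB , boundB , u∈B , b∈B = cycle ub (≤-trans (<⇒≤ u<c) c≤r)
          u∈A = Block.shared-level blockA c∈A a∈A (Adj⇒≢ G (proj₁ ca)) (proj₂ ca)
          u′∈A = Block.shared-level blockA a∈A c∈A (Adj⇒≢ G (proj₁ ca) ∘ sym) (sym (proj₂ ca))
          p∈A = Block.shared-level blockA u∈A u′∈A p≢p (level-parent≡ 0<c 0<a (proj₂ ca))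
          p∈B = Block.shared-level blockB u∈B b∈B (Adj⇒≢ G (proj₁ ub)) (proj₂ ub)
      in no-common-parent-edge blockA boundA blockB boundB 0<u u∈A u∈B p∈A p∈B c∈A b∈B
           (uc , lc) (proj₁ ub) (≤-reflexive (proj₂ ub))
           (level>⇒≢ (<-≤-trans (s≤s (≤-reflexive (sym (proj₂ ub)))) u<c))

  private
    -- A horizontal edge between nodes with distinct parents closes a cycle that climbs at least two
    -- levels, so both grandparents belong to it.
    module Cousins (hst : Horizontal s a) (s≤r : level s ≤ r) (ps≢pa : parent s ≢ parent a) where
      0<s : 0 < level s
      0<s = Horizontal-pos hst

      0<a : 0 < level a
      0<a = Horizontal-pos (Horizontal-sym hst)

      ps~pa : level (parent s) ≡ level (parent a)
      ps~pa = level-parent≡ 0<s 0<a (proj₂ hst)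

      0<ps : 0 < level (parent s)
      0<ps = level-pos ps≢pa ps~pa

      0<pa : 0 < level (parent a)
      0<pa = level-pos (ps≢pa ∘ sym) (sym ps~pa)

      C : Subset n
      C = proj₁ (cycle hst s≤r)

      block : Block C
      block = proj₁ (proj₂ (cycle hst s≤r))

      bounded : Bounded C
      bounded = proj₁ (proj₂ (proj₂ (cycle hst s≤r)))

      s∈ : s ∈ C
      s∈ = proj₁ (proj₂ (proj₂ (proj₂ (cycle hst s≤r))))

      a∈ : a ∈ C
      a∈ = proj₂ (proj₂ (proj₂ (proj₂ (cycle hst s≤r))))

      ps∈ : parent s ∈ C
      ps∈ = Block.shared-level block s∈ a∈ (Adj⇒≢ G (proj₁ hst)) (proj₂ hst)

      pa∈ : parent a ∈ C
      pa∈ = Block.shared-level block a∈ s∈ (Adj⇒≢ G (proj₁ hst) ∘ sym) (sym (proj₂ hst))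

      pps∈ : parent (parent s) ∈ C
      pps∈ = Block.shared-level block ps∈ pa∈ ps≢pa ps~pa

      ppa∈ : parent (parent a) ∈ C
      ppa∈ = Block.shared-level block pa∈ ps∈ (ps≢pa ∘ sym) (sym ps~pa)

  -- If the two grandparents coincide, a horizontal edge there would be a fourth one. If not, the
  -- cycle climbs further and shares the edge above `parent (parent s)` with the cycle of that
  -- horizontal edge.
  cousins-grandparent : Horizontal s a → level s ≤ r → parent s ≢ parent a →
                        ¬ Horizontal (parent (parent s)) b
  cousins-grandparent {s} {a} {b} hsa s≤r ps≢pa hgb = go (g ≟ᶠ parent (parent a))
    where
    open Cousins hsa s≤r ps≢pa
    g = parent (parent s)

    0<g : 0 < level g
    0<g = Horizontal-pos hgb

    g<ps : level g < level (parent s)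
    g<ps = level-parent< 0<ps

    g≤r : level g ≤ r
    g≤r = ≤-trans (<⇒≤ (<-trans g<ps (level-parent< 0<s))) s≤r

    b<ps : level b < level (parent s)
    b<ps = ≤-<-trans (≤-reflexive (sym (proj₂ hgb))) g<ps

    go : Dec (g ≡ parent (parent a)) → ⊥ᵗ
    go (yes eq) = no-four-neighbours
      (proj₁ (Child-parent 0<ps)) (subst (λ p → Adj p (parent a)) (sym eq) (proj₁ (Child-parent 0<pa)))
      (proj₁ hgb) (parent-adj 0<g)
      ps≢pa (level>⇒≢ b<ps) (level>⇒≢ (<-trans (level-parent< 0<g) g<ps))
      (level>⇒≢ (<-≤-trans b<ps (≤-reflexive ps~pa)))
      (level>⇒≢ (<-≤-trans (<-trans (level-parent< 0<g) g<ps) (≤-reflexive ps~pa)))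
      (level>⇒≢ (<-≤-trans (level-parent< 0<g) (≤-reflexive (proj₂ hgb))))
    go (no g≢) =
      let B , blockB , boundB , g∈B , b∈B = cycle hgb g≤r
          pg∈C = Block.shared-level block pps∈ ppa∈ g≢ (level-parent≡ 0<ps 0<pa ps~pa)
          pg∈B = Block.shared-level blockB g∈B b∈B (Adj⇒≢ G (proj₁ hgb)) (proj₂ hgb)
      in no-common-parent-edge block bounded blockB boundB 0<g pps∈ g∈B pg∈C pg∈B ps∈ b∈B
           (Child-parent 0<ps) (proj₁ hgb) (≤-reflexive (proj₂ hgb)) (level>⇒≢ b<ps)

  -- Let `h` be the common parent of `a` and `z`. If `b` is also a child of `h`, then `h` has four
  -- neighbours; if not, the cycle of `z` and `b` shares with the cousins' cycle the edge from `h`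
  -- to its parent.
  cousins-sibling : Horizontal s a → level s ≤ r → parent s ≢ parent a →
                    Child (parent a) z → z ≢ a → ¬ Horizontal z b
  cousins-sibling {s} {a} {z} {b} hsa s≤r ps≢pa (pz , lz) z≢a hzb = go (h ≟ᶠ parent b)
    where
    open Cousins hsa s≤r ps≢pa
    h = parent a

    h≡pz : h ≡ parent z
    h≡pz = unique-parent (pz , lz) (≤-trans (≤-reflexive (trans lz (trans (parent-level 0<a) (sym (proj₂ hsa))))) s≤r)

    z~a : level z ≡ level a
    z~a = trans lz (parent-level 0<a)

    z≤r : level z ≤ r
    z≤r = ≤-trans (≤-reflexive (trans z~a (sym (proj₂ hsa)))) s≤r

    0<b : 0 < level b
    0<b = Horizontal-pos (Horizontal-sym hzb)

    ph<z : level (parent h) < level z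
    ph<z = <-trans (level-parent< 0<pa) (<-≤-trans (level-parent< 0<a) (≤-reflexive (sym z~a)))

    go : Dec (h ≡ parent b) → ⊥ᵗ
    go (yes eq) = no-four-neighbours
      (proj₁ (Child-parent 0<a)) pz (subst (λ p → Adj p b) (sym eq) (proj₁ (Child-parent 0<b))) (parent-adj 0<pa)
      (z≢a ∘ sym) a≢b
      (level>⇒≢ (<-≤-trans ph<z (≤-reflexive z~a)))
      (Adj⇒≢ G (proj₁ hzb)) (level>⇒≢ ph<z) (level>⇒≢ (<-≤-trans ph<z (≤-reflexive (proj₂ hzb))))
      where
      -- If `b` were `a`, the uniqueness of the horizontal edge at `a` would give `z = s`, and then
      -- `s` and `a` would not be cousins.
      a≢b : a ≢ b
      a≢b refl = ps≢pa (trans (cong parent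
        (unique-horizontal (Horizontal-sym hsa) (Horizontal-sym hzb) (≤-trans (≤-reflexive (sym (proj₂ hsa))) s≤r)))
        (sym h≡pz))
    go (no y≢) =
      let B , blockB , boundB , z∈B , b∈B = cycle hzb z≤r
          0<z   = Horizontal-pos hzb
          pz∈B  = Block.shared-level blockB z∈B b∈B (Adj⇒≢ G (proj₁ hzb)) (proj₂ hzb)
          pb∈B  = Block.shared-level blockB b∈B z∈B (Adj⇒≢ G (proj₁ hzb) ∘ sym) (sym (proj₂ hzb))
          h∈B   = subst (_∈ B) (sym h≡pz) pz∈B
          ph∈B  = Block.shared-level blockB h∈B pb∈B y≢
                    (trans (cong level h≡pz) (level-parent≡ 0<z 0<b (proj₂ hzb)))
      in no-common-parent-edge block bounded blockB boundB 0<pa pa∈ h∈B ppa∈ ph∈B a∈ z∈B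
           (Child-parent 0<a) pz (<⇒≤ (≤-reflexive (sym lz))) (z≢a ∘ sym)

  not-parent : Adj u x → x ≢ parent u → level u ≤ r → Horizontal u x ⊎ Child u x
  not-parent {u} {x} ux x≢p u≤r with <-cmp (level x) (level u)
  ... | tri< x<u _ _ = ⊥-elim (x≢p (unique-parent
          (adj-sym G ux , ≤-antisym (adj-level (adj-sym G ux)) x<u) u≤r))
  ... | tri≈ _ eq _ = inj₁ (ux , sym eq)
  ... | tri> _ _ u<x = inj₂ (ux , ≤-antisym (adj-level ux) u<x)

  -- Of the three neighbours, at most one is the parent and at most one is horizontal.
  Two⊎One : level u ≤ r → Two u ⊎ One u
  Two⊎One {u} u≤r =
    let three = ≤-reflexive (sym (deg≡3 u u≤r))
        a , ua , a≢ = fresh (nbhd u) (parent u ∷ []) (≤-trans (s≤s (s≤s z≤n)) three)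
        b , ub , b≢ = fresh (nbhd u) (parent u ∷ a ∷ []) three
    in choose (All.head (All.tail b≢) ∘ sym) (not-parent ua (All.head a≢) u≤r) (not-parent ub (All.head b≢) u≤r)
    where
    one : ∀ {q c} → Horizontal u q → Child u c → One u
    one {q} {c} hq (uc , lc) = q , c , hq , (uc , lc) , λ {z} → only {z}
      where
      0<u = Horizontal-pos hq

      child>q : ∀ {z} → Child u z → level q < level z
      child>q (_ , lz) = ≤-trans (s≤s (≤-reflexive (sym (proj₂ hq)))) (≤-reflexive (sym lz))

      child>p : ∀ {z} → Child u z → level (parent u) < level z
      child>p (_ , lz) = <-trans (level-parent< 0<u) (≤-reflexive (sym lz))

      -- The parent, `q` and `c` already use up the degree.
      only : ∀ {z} → Child u z → z ≡ c
      only {z} cz with z ≟ᶠ c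
      ... | yes eq = eq
      ... | no z≢c = ⊥-elim (no-four-neighbours (proj₁ cz) uc (proj₁ hq) (parent-adj 0<u)
        z≢c (level>⇒≢ (child>q cz)) (level>⇒≢ (child>p cz))
        (level>⇒≢ (child>q (uc , lc))) (level>⇒≢ (child>p (uc , lc)))
        (level>⇒≢ (<-≤-trans (level-parent< 0<u) (≤-reflexive (proj₂ hq)))))

    choose : ∀ {a b} → a ≢ b → Horizontal u a ⊎ Child u a → Horizontal u b ⊎ Child u b → Two u ⊎ One u
    choose a≢b (inj₁ ha) (inj₁ hb) = ⊥-elim (a≢b (unique-horizontal ha hb u≤r))
    choose a≢b (inj₁ ha) (inj₂ cb) = inj₂ (one ha cb)
    choose a≢b (inj₂ ca) (inj₁ hb) = inj₂ (one hb ca)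
    choose a≢b (inj₂ ca) (inj₂ cb) = inj₁ (_ , _ , a≢b , ca , cb)

-- Marked nodes and the nodes that mark them.

module Marks {n : ℕ} {G : Graph n} (M : Marking G 15) where
  open Graph G
  open Marking M

  private variable
    c d s t : Fin n

  Marks : Fin n → Fin n → Set
  Marks s c = StaysSelected s × Picked (pick s) c

  private
    picked? : (p : Dec (NonAdjacentNeighbours G s)) → ∀ c → Dec (Picked p c)
    picked? (yes p) c = (c ≟ᶠ _) ⊎-dec (c ≟ᶠ _)
    picked? (no _)  c = no λ ()

    picked-adj : (p : Dec (NonAdjacentNeighbours G s)) → Picked p c → Adj s c
    picked-adj (yes p) (inj₁ refl) = NonAdjacentNeighbours.x-neighbour p
    picked-adj (yes p) (inj₂ refl) = NonAdjacentNeighbours.y-neighbour p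

    picked-nonadjacent : (p : Dec (NonAdjacentNeighbours G s)) → Picked p c → Picked p d → ¬ Adj c d
    picked-nonadjacent (yes p) (inj₁ refl) (inj₁ refl) cd = loopless _ cd
    picked-nonadjacent (yes p) (inj₁ refl) (inj₂ refl) cd = NonAdjacentNeighbours.nonadjacent p cd
    picked-nonadjacent (yes p) (inj₂ refl) (inj₁ refl) cd = NonAdjacentNeighbours.nonadjacent p (adj-sym G cd)
    picked-nonadjacent (yes p) (inj₂ refl) (inj₂ refl) cd = loopless _ cd

    picked-pair : (p : Dec (NonAdjacentNeighbours G s)) → Picked p c →
                  ∃[ x ] ∃[ y ] x ≢ y × Adj s x × Adj s y × Picked p x × Picked p y
    picked-pair (yes p) _ =
      let open NonAdjacentNeighbours p
      in x , y , distinct , x-neighbour , y-neighbour , inj₁ refl , inj₂ refl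

  staysSelected? : ∀ s → Dec (StaysSelected s)
  staysSelected? s = (s ∈? selected) ×-dec
    map′ (λ h {t} → h t) (λ h t → h {t})
      (all? (λ t → (t ∈? selected) →-dec ((¬? (t ≟ᶠ s)) →-dec (¬? (within? G (λ _ → yes _) 15 s t)))))

  marked? : ∀ c → Dec (Marked c)
  marked? c = any? (λ s → staysSelected? s ×-dec picked? (pick s) c)

  unmarked? : ∀ c → Dec (Unmarked c)
  unmarked? c = ¬? (marked? c)

  marks-adj : Marks s c → Adj s c
  marks-adj (_ , pc) = picked-adj (pick _) pc

  marks-nonadjacent : Marks s c → Marks s d → ¬ Adj c d
  marks-nonadjacent (_ , pc) (_ , pd) = picked-nonadjacent (pick _) pc pd

  -- A node that marks anything marks two neighbours. Hence without reached T-nodes, markers can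
  -- only lie outside the reached part.
  marks-TNode : Marks s c → TNode s
  marks-TNode {s} (stays , pc) =
    let x , y , x≢y , sx , sy , px , py = picked-pair (pick s) pc
    in x , y , x≢y , sx , sy , (s , stays , px) , (s , stays , py)

  marks-unique : Marks s c → Marks t d → Within G U 15 s t → s ≡ t
  marks-unique {s} {t = t} ((s∈ , far) , _) ((t∈ , _) , _) near with t ≟ᶠ s
  ... | yes eq = sym eq
  ... | no t≢s = ⊥-elim (far t∈ t≢s near)

-- Events, and what two nearby events imply.

module Events {n : ℕ} {G : Graph n} {v : Fin n} {r : ℕ} (sparse : Sparse G v r) (M : Marking G 15)
              (noTNode : ∀ {s} → Marking.HopComponent M r v s → ¬ Marking.TNode M s) where
  open Graph G
  open Distances (Sparse.distance sparse)
  open Layers (Sparse.distance sparse)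
  open Structure sparse
  open Marking M
  open Marks M

  private variable
    a b c d e f s t u w x : Fin n
    i j k : ℕ

  -- The walk of unmarked nodes has to be a shortest one, so that the limit on the number of hops
  -- becomes the condition that the level is at most `r`.
  Reached : Fin n → Set
  Reached u = Within G Unmarked (level u) v u

  Event : Fin n → Set
  Event e = ∃[ c ] Child e c × Marked c

  data Descends : ℕ → Fin n → Fin n → Set where
    here  : Descends 0 u u
    below : Child u c → Unmarked c → Descends i c w → Descends (suc i) u w

  Descends-trans : Descends i u w → Descends j w x → Descends (i + j) u x
  Descends-trans here            ws = ws
  Descends-trans (below uc c us) ws = below uc c (Descends-trans us ws)

  Descends-level : Descends i u w → level w ≡ i + level u
  Descends-level here = refl
  Descends-level {suc i} (below (_ , lc) _ us) =
    trans (Descends-level us) (trans (cong (i +_) lc) (+-suc i _))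

  Descends-near : Descends i u w → Within G U i u w
  Descends-near here = 0 , z≤n , stop _
  Descends-near (below (uc , _) _ us) =
    let l , l≤i , ws = Descends-near us in suc l , s≤s l≤i , step _ uc ws

  Descends-reached : Reached u → Descends i u w → Reached w
  Descends-reached ru here = ru
  Descends-reached (l , l≤ , ws) (below (uc , lc) c us) =
    Descends-reached (suc l , ≤-trans (s≤s l≤) (≤-reflexive (sym lc)) , snoc G ws uc c) us

  Descends-level≤ : Descends i u w → level u ≤ level w
  Descends-level≤ us = ≤-trans (m≤n+m _ _) (≤-reflexive (sym (Descends-level us)))

  same-ancestor : Descends i u x → Descends i w x → level x ≤ r → u ≡ w
  same-ancestor here            here            x≤r = refl
  same-ancestor (below uc _ us) (below wd _ ws) x≤r
    with same-ancestor us ws x≤r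
  ... | refl = let c≤r = ≤-trans (Descends-level≤ us) x≤r
               in trans (unique-parent uc c≤r) (sym (unique-parent wd c≤r))

  reached-marks-nothing : Reached u → level u ≤ r → ¬ Marks u c
  reached-marks-nothing ru u≤r m = noTNode (within-≤ G u≤r ru) (marks-TNode m)

  -- The parent of `c` is `e`, which is reached and therefore marks nothing. So the marker
  -- approaches `c` from the side or from below.
  marker-side : Reached e → Child e c → level c ≤ r → Marks s c → Horizontal c s ⊎ Child c s
  marker-side {e} {c} {s} re ec c≤r m = not-parent (adj-sym G (marks-adj m)) s≢ c≤r
    where
    s≢ : s ≢ parent c
    s≢ eq = reached-marks-nothing re
      (≤-trans (n≤1+n _) (≤-trans (≤-reflexive (sym (proj₂ ec))) c≤r))
      (subst (λ x → Marks x c) (trans eq (sym (unique-parent ec c≤r))) m)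

  -- κ and φ are the two nodes marked by σ.
  record Upper (e b : Fin n) : Set where
    field
      {σ κ φ} : Fin n
      ec  : Child e κ
      cs  : Child κ σ
      bf  : Child b φ
      sf  : Horizontal σ φ
      c≁f : ¬ Adj κ φ
      s≤r : level σ ≤ r
      marked-f : Marked φ

    c≡ps : κ ≡ parent σ
    c≡ps = unique-parent cs s≤r

    b≡pf : b ≡ parent φ
    b≡pf = unique-parent bf (≤-trans (≤-reflexive (sym (proj₂ sf))) s≤r)

    e≡pps : e ≡ parent (parent σ)
    e≡pps = trans (unique-parent ec (≤-trans (≤-trans (n≤1+n _) (≤-reflexive (sym (proj₂ cs)))) s≤r)) (cong parent c≡ps)

    -- The parent of `σ` is `κ`, which is not adjacent to `φ` since a selected node marks
    -- non-adjacent neighbours; the parent of `φ` is `b`, which is adjacent to `φ`.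
    cousins : parent σ ≢ parent φ
    cousins eq = c≁f (subst (λ x → Adj x φ) (trans b≡pf (trans (sym eq) (sym c≡ps))) (proj₁ bf))

    level-b : level b ≡ suc (level e)
    level-b = suc-injective (trans (sym (proj₂ bf)) (trans (sym (proj₂ sf)) (trans (proj₂ cs) (cong suc (proj₂ ec)))))

    -- `e` is the grandparent of `σ`, and the edge between `σ` and `φ` joins cousins.
    ¬One-upper : ¬ One e
    ¬One-upper (_ , _ , h , _) =
      cousins-grandparent sf s≤r cousins (subst (λ x → Horizontal x _) e≡pps h)

    -- The child `φ` of `b` has a horizontal edge already.
    ¬One-lower : ¬ One b
    ¬One-lower (_ , _ , h , _) = child-horizontal bf h (Horizontal-sym sf) (≤-trans (≤-reflexive (sym (proj₂ sf))) s≤r)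

    ¬One-sibling : Child b d → Unmarked d → ¬ One d
    ¬One-sibling bd um (_ , _ , h , _) = cousins-sibling sf s≤r cousins
      (subst (λ x → Child x _) b≡pf bd) (λ { refl → um marked-f }) h

  marker-near : Child e c → Marks s c → Within G U 2 e s
  marker-near (ec , _) m = 2 , ≤-refl , step _ ec (step _ (adj-sym G (marks-adj m)) (stop _))

  -- Two steps from `s` to `e`, eleven from `e` to `b` and two from `b` to `t` stay within the
  -- backoff distance 15.
  same-marker : Within G U 11 e b → Child e c → Marks s c → Child b f → Marks t f → s ≡ t
  same-marker near ec ms bf mt = marks-unique ms mt
    (within-trans G (within-sym G (marker-near ec ms)) (within-trans G near (marker-near bf mt)))

  level-child≤ : Child u c → 2 + level u ≤ r → level c ≤ r
  level-child≤ (_ , lc) u≤ = ≤-trans (≤-reflexive lc) (≤-trans (n≤1+n _) u≤)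

  level-grandchild≤ : Child u c → Child c d → 2 + level u ≤ r → level d ≤ r
  level-grandchild≤ (_ , lc) (_ , ld) u≤ = ≤-trans (≤-reflexive (trans ld (cong suc lc))) u≤

  -- Both marks come from one node `s`. As `a` and `b` are on the same level, `s` is beside both or
  -- below both, and a node has only one horizontal neighbour and only one parent.
  two-marked-children : Reached u → 2 + level u ≤ r → Child u a → Child u b →
                        Marked a → Marked b → a ≡ b
  two-marked-children {u} {a} {b} ru u≤ ua ub (s , ms) (t , mt)
    with same-marker (0 , z≤n , stop _) ua ms ub mt
  ... | refl with marker-side ru ua (level-child≤ ua u≤) ms | marker-side ru ub (level-child≤ ub u≤) mt
  ...   | inj₁ ha | inj₁ hb = unique-horizontal (Horizontal-sym ha) (Horizontal-sym hb)
                                (≤-trans (≤-reflexive (sym (proj₂ ha))) (level-child≤ ua u≤))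
  ...   | inj₁ ha | inj₂ cb = ⊥-elim (1+n≢n (trans (sym (proj₂ cb))
                                (trans (sym (proj₂ ha)) (trans (proj₂ ua) (sym (proj₂ ub))))))
  ...   | inj₂ ca | inj₁ hb = ⊥-elim (1+n≢n (trans (sym (proj₂ ca))
                                (trans (sym (proj₂ hb)) (trans (proj₂ ub) (sym (proj₂ ua))))))
  ...   | inj₂ ca | inj₂ cb = trans (unique-parent ca (level-grandchild≤ ua ca u≤))
                                (sym (unique-parent cb (level-grandchild≤ ub cb u≤)))

  -- Were the common marker beside both marked children, or below both, these children and hence `e`
  -- and `b` would coincide. So it is below one child and beside the other.
  event-pair : Reached e → Reached b → 2 + level e ≤ r → 2 + level b ≤ r → Within G U 11 e b →
               Event e → Event b → e ≢ b → Upper e b ⊎ Upper b e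
  event-pair {e} {b} re rb e≤ b≤ near (c , ec , s , ms) (f , bf , t , mt) e≢b
    with same-marker near ec ms bf mt
  ... | refl with marker-side re ec (level-child≤ ec e≤) ms | marker-side rb bf (level-child≤ bf b≤) mt
  ...   | inj₁ hc | inj₁ hf = ⊥-elim (e≢b (trans (unique-parent ec (level-child≤ ec e≤))
            (trans (cong parent (unique-horizontal (Horizontal-sym hc) (Horizontal-sym hf)
                     (≤-trans (≤-reflexive (sym (proj₂ hc))) (level-child≤ ec e≤))))
              (sym (unique-parent bf (level-child≤ bf b≤))))))
  ...   | inj₂ cs | inj₂ fs = ⊥-elim (e≢b (trans (unique-parent ec (level-child≤ ec e≤))
            (trans (cong parent (trans (unique-parent cs (level-grandchild≤ ec cs e≤))
                     (sym (unique-parent fs (level-grandchild≤ bf fs b≤)))))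
              (sym (unique-parent bf (level-child≤ bf b≤))))))
  ...   | inj₂ cs | inj₁ hf = inj₁ (record { ec = ec ; cs = cs ; bf = bf ; sf = Horizontal-sym hf
            ; c≁f = marks-nonadjacent ms mt ; s≤r = level-grandchild≤ ec cs e≤ ; marked-f = t , mt })
  ...   | inj₁ hc | inj₂ fs = inj₂ (record { ec = bf ; cs = fs ; bf = ec ; sf = Horizontal-sym hc
            ; c≁f = marks-nonadjacent mt ms ; s≤r = level-grandchild≤ bf fs b≤ ; marked-f = s , ms })

-- Counting with duplicate-free lists.

module _ {A : Set} where

  private variable
    P Q R : Pred A 0ℓ
    k l : ℕ

  Many : ℕ → Pred A 0ℓ → Set
  Many k P = ∃[ xs ] k ≤ length xs × Unique xs × All P xs

  many-map : (∀ {x} → P x → Q x) → Many k P → Many k Q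
  many-map f (xs , k≤ , uxs , pxs) = xs , k≤ , uxs , All.map f pxs

  many-≤ : k ≤ l → Many l P → Many k P
  many-≤ k≤l (xs , l≤ , rest) = xs , ≤-trans k≤l l≤ , rest

  many-one : ∀ {x} → P x → Many 1 P
  many-one p = _ ∷ [] , ≤-refl , [] ∷ [] , p ∷ []

  many-++ : (∀ {x} → P x → R x) → (∀ {x} → Q x → R x) → (∀ {x} → P x → ¬ Q x) →
            Many k P → Many l Q → Many (k + l) R
  many-++ f g disjoint (xs , k≤ , uxs , pxs) (ys , l≤ , uys , qys) =
    xs ++ ys ,
    ≤-trans (+-mono-≤ k≤ l≤) (≤-reflexive (sym (length-++ xs))) ,
    Uniqueₚ.++⁺ uxs uys (λ (z∈xs , z∈ys) → disjoint (All.lookup pxs z∈xs) (All.lookup qys z∈ys)) ,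
    Allₚ.++⁺ (All.map f pxs) (All.map g qys)

  many-bind : ∀ {B : A → Pred A 0ℓ} → Many k P → (∀ {x} → P x → Many l (B x)) →
              (∀ {x y z} → P x → P y → B x z → B y z → x ≡ y) →
              Many (k * l) (λ z → ∃[ x ] P x × B x z)
  many-bind {k} {P = P} {l} {B} (xs , k≤ , uxs , pxs) f disjoint =
    let zs , len , uzs , bzs = go uxs pxs
    in zs , ≤-trans (*-monoˡ-≤ l k≤) len , uzs , All.map Any.satisfied bzs
    where
    go : ∀ {xs} → Unique xs → All P xs →
         ∃[ zs ] length xs * l ≤ length zs × Unique zs × All (λ z → Any (λ x → P x × B x z) xs) zs
    go [] [] = [] , z≤n , [] , []
    go (x∉ ∷ uxs) (px ∷ pxs) =
      let ys , l≤ , uys , bys = f px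
          zs , len , uzs , bzs = go uxs pxs
      in ys ++ zs ,
         ≤-trans (+-mono-≤ l≤ len) (≤-reflexive (sym (length-++ ys))) ,
         Uniqueₚ.++⁺ uys uzs (λ (z∈ys , z∈zs) →
           let x≢y , py , byz = All.lookupAny x∉ (All.lookup bzs z∈zs)
           in x≢y (disjoint px py (All.lookup bys z∈ys) byz)) ,
         Allₚ.++⁺ (All.map (λ b → here (px , b)) bys) (All.map there bzs)

  many-drop : (∀ {x} → P x → Q x ⊎ R x) → (∀ {x y} → P x → P y → R x → R y → x ≡ y) →
              Many (suc k) P → Many k Q
  many-drop {P = P} {Q} {R} split unique (xs , k< , uxs , pxs) =
    let ys , len , uys , qys , _ = go uxs pxs in ys , s≤s⁻¹ (≤-trans k< len) , uys , qys
    where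
    all-Q : ∀ {xs} → (∀ {x} → P x → ¬ (Any (x ≡_) xs × R x)) → All P xs → All Q xs
    all-Q ¬R []         = []
    all-Q ¬R (px ∷ pxs) with split px
    ... | inj₁ q = q ∷ all-Q (λ p (i , r) → ¬R p (there i , r)) pxs
    ... | inj₂ r = ⊥-elim (¬R px (here refl , r))

    -- The last component says that `ys` is contained in `xs`; it keeps the result free of
    -- duplicates.
    go : ∀ {xs} → Unique xs → All P xs →
         ∃[ ys ] length xs ≤ suc (length ys) × Unique ys × All Q ys × (∀ {z} → All (z ≢_) xs → All (z ≢_) ys)
    go [] [] = [] , z≤n , [] , [] , λ _ → []
    go {x ∷ xs} (x∉ ∷ uxs) (px ∷ pxs) with split px
    ... | inj₁ q = let ys , len , uys , qys , sub = go uxs pxs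
                   in x ∷ ys , s≤s len , sub x∉ ∷ uys , q ∷ qys , λ { (z≢x ∷ z∉) → z≢x ∷ sub z∉ }
    ... | inj₂ r = xs , ≤-refl , uxs ,
                   all-Q (λ {y} py (i , ry) → All.lookupWith (λ x≢y y≡ → x≢y (trans (unique px py r ry) y≡)) x∉ i) pxs ,
                   All.tail

many⇒AtLeast : ∀ {n k} {P : Pred (Fin n) 0ℓ} → Many k P → AtLeast k P
many⇒AtLeast {n} {P = P} (xs , k≤ , uxs , pxs) =
  S xs , ≤-trans k≤ (Unique⇒length≤∣p∣ (S xs) uxs (members xs)) , sound pxs
  where
  S : List (Fin n) → Subset n
  S []       = ⊥
  S (x ∷ xs) = S xs ∪ ⁅ x ⁆

  members : ∀ xs → All (_∈ S xs) xs
  members []       = []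
  members (x ∷ xs) = x∈p∪⁅x⁆ (S xs) x ∷ All.map (p⊆p∪q ⁅ x ⁆) (members xs)

  sound : ∀ {xs} → All P xs → ∀ {u} → u ∈ S xs → P u
  sound []         u∈ = ⊥-elim (∉⊥ u∈)
  sound {x ∷ xs} (px ∷ pxs) u∈ with x∈p∪⁅y⁆⁻ (S xs) x u∈
  ... | inj₁ u∈S  = sound pxs u∈S
  ... | inj₂ refl = px

-- Counting descendants over a few levels.

module Growth {n : ℕ} {G : Graph n} {v : Fin n} {r : ℕ} (sparse : Sparse G v r) (M : Marking G 15)
              (noTNode : ∀ {s} → Marking.HopComponent M r v s → ¬ Marking.TNode M s) where
  open Graph G
  open Distances (Sparse.distance sparse)
  open Structure sparse
  open Marking M
  open Marks M
  open Events sparse M noTNode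

  private variable
    a b c d e f g s t u w x y z : Fin n
    i j k l : ℕ

  Alive : Fin n → Set
  Alive w = ∃[ c ] Child w c × Unmarked c

  Dead : Fin n → Set
  Dead w = One w × Event w

  -- The two levels added to k are those of a marked child of the last level and of its marker.
  Deep : ℕ → Fin n → Set
  Deep k u = Reached u × 2 + (k + level u) ≤ r

  deep-below : Deep (suc k) u → Child u c → Unmarked c → Deep k c
  deep-below {k} (ru , u≤) uc um =
    Descends-reached ru (below uc um here) ,
    ≤-trans (≤-reflexive (cong (2 +_) (trans (cong (k +_) (proj₂ uc)) (+-suc k _)))) u≤

  deep-≤ : j ≤ k → Deep k u → Deep j u
  deep-≤ {u = u} j≤k (ru , u≤) = ru , ≤-trans (s≤s (s≤s (+-monoˡ-≤ (level u) j≤k))) u≤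

  deep-descends : Deep k u → Descends i u w → i ≤ k → Deep (k ∸ i) w
  deep-descends deep here z≤n = deep
  deep-descends deep (below uc um us) (s≤s i≤k) = deep-descends (deep-below deep uc um) us i≤k

  deep-level : Deep k u → 2 + level u ≤ r
  deep-level {k} (_ , u≤) = ≤-trans (s≤s (s≤s (m≤n+m _ k))) u≤

  deep-bound : Deep k u → Descends i u w → i ≤ suc k → level w ≤ r
  deep-bound {k} {u} {i} (_ , u≤) us i≤ = ≤-trans (≤-reflexive (Descends-level us))
    (≤-trans (+-monoˡ-≤ (level u) i≤) (≤-trans (n≤1+n _) u≤))

  child? : ∀ u c → Dec (Child u c)
  child? u c = adj? G u c ×-dec (level c ≟ suc (level u))

  event? : ∀ u → Dec (Event u)
  event? u = any? (λ c → child? u c ×-dec marked? c)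

  HasEvent : ℕ → Fin n → Set
  HasEvent k u = ∃[ i ] ∃[ e ] i < k × Descends i u e × Event e

  hasEvent? : ∀ k u → Dec (HasEvent k u)
  hasEvent? zero    u = no λ ()
  hasEvent? (suc k) u with event? u
  ... | yes ev = yes (0 , u , z<s , here , ev)
  ... | no ¬ev = map′
    (λ (c , uc , um , i , e , i<k , us , ev) → suc i , e , s<s i<k , below uc um us , ev)
    (λ { (zero , _ , _ , here , ev) → ⊥-elim (¬ev ev)
       ; (suc i , e , s<s i<k , below uc um us , ev) → _ , uc , um , i , e , i<k , us , ev })
    (any? (λ c → child? u c ×-dec unmarked? c ×-dec hasEvent? k c))

  -- Events are excluded at depths below `k`, so the marks are excluded down to depth `k` inclusive.
  Clean : ℕ → Fin n → Set
  Clean k u = ¬ HasEvent k u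

  clean-below : Clean (suc k) u → Child u c → Unmarked c → Clean k c
  clean-below clean uc um (i , e , i<k , us , ev) = clean (suc i , e , s<s i<k , below uc um us , ev)

  clean-unmarked : Clean (suc k) u → Child u c → Unmarked c
  clean-unmarked clean uc m = clean (0 , _ , z<s , here , _ , uc , m)

  -- With two children, at most one is marked; only a node with a single child can be a dead end.
  Alive⊎Dead : Deep k w → Alive w ⊎ Dead w
  Alive⊎Dead deep with Two⊎One (≤-trans (m≤n+m _ 2) (deep-level deep))
  ... | inj₁ (a , b , a≢b , wa , wb) with marked? a | marked? b
  ...   | no um  | _      = inj₁ (a , wa , um)
  ...   | yes _  | no um  = inj₁ (b , wb , um)
  ...   | yes ma | yes mb = ⊥-elim (a≢b (two-marked-children (proj₁ deep) (deep-level deep) wa wb ma mb))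
  Alive⊎Dead deep | inj₂ one@(q , c , h , wc , _) with marked? c
  ...   | no um = inj₁ (c , wc , um)
  ...   | yes m = inj₂ (one , c , wc , m)

  AllAlive : ℕ → Fin n → Set
  AllAlive k u = ∀ {i w} → i < k → Descends i u w → Alive w

  alive-below : AllAlive (suc k) u → Child u c → Unmarked c → AllAlive k c
  alive-below alive uc um i<k us = alive (s<s i<k) (below uc um us)

  clean⇒alive : Deep k u → Clean k u → AllAlive k u
  clean⇒alive deep clean i<k us with Alive⊎Dead (deep-descends deep us (<⇒≤ i<k))
  ... | inj₁ alive    = alive
  ... | inj₂ (_ , ev) = ⊥-elim (clean (_ , _ , i<k , us , ev))

  single : Child u c → Unmarked c → Many l (Descends i c) → Many l (Descends (suc i) u)
  single uc um = many-map (below uc um)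

  Descends-disjoint : level a ≡ level b → Descends i a z → Descends j b z → level z ≤ r → a ≡ b
  Descends-disjoint {i = i} {j = j} eq as bs z≤r
    with +-cancelʳ-≡ _ i j (trans (sym (Descends-level as)) (trans (Descends-level bs) (cong (j +_) (sym eq))))
  ... | refl = same-ancestor as bs z≤r

  children-level : Child u a → Child u b → level a ≡ level b
  children-level (_ , la) (_ , lb) = trans la (sym lb)

  fork : Deep i u → Child u a → Child u b → a ≢ b → Unmarked a → Unmarked b →
         Many k (Descends i a) → Many l (Descends i b) → Many (k + l) (Descends (suc i) u)
  fork deep ua ub a≢b uma umb = many-++ (below ua uma) (below ub umb) λ as bs →
    a≢b (same-ancestor as bs (deep-bound deep (below ua uma as) ≤-refl))

  some-descendant : ∀ i → AllAlive i u → Many 1 (Descends i u)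
  some-descendant zero    alive = many-one here
  some-descendant (suc i) alive =
    let c , uc , um = alive z<s here in single uc um (some-descendant i (alive-below alive uc um))

  One-child-Two : Deep (suc k) u → One u → Child u c → Two c
  One-child-Two deep (_ , _ , h , _) uc with Two⊎One (level-child≤ uc (deep-level deep))
  ... | inj₁ two = two
  ... | inj₂ (_ , _ , h′ , _) = ⊥-elim (child-horizontal uc h h′ (level-child≤ uc (deep-level deep)))

  kind : Deep k u → Two u ⊎ One u
  kind deep = Two⊎One (≤-trans (m≤n+m _ 2) (deep-level deep))

  -- In this family the subscript is the number of levels that the branching needs; the remaining
  -- `j` levels are only descended. A start with two children saves one level.
  two-clean₁ : ∀ j → Deep (1 + j) u → Two u → Clean (1 + j) u → Many 2 (Descends (1 + j) u)
  two-clean₁ j deep (a , b , a≢b , ua , ub) clean =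
    fork (deep-≤ (n≤1+n j) deep) ua ub a≢b uma umb (descend ua uma) (descend ub umb)
    where
    uma = clean-unmarked clean ua
    umb = clean-unmarked clean ub
    descend : ∀ {c} → Child _ c → Unmarked c → Many 1 (Descends j c)
    descend uc um = some-descendant j (clean⇒alive (deep-below deep uc um) (clean-below clean uc um))

  clean₂ : ∀ j → Deep (2 + j) u → Clean (2 + j) u → Many 2 (Descends (2 + j) u)
  clean₂ j deep clean with kind deep
  ... | inj₁ two = two-clean₁ (suc j) deep two clean
  ... | inj₂ one@(_ , c , _ , uc , _) =
    let um = clean-unmarked clean uc
    in single uc um (two-clean₁ j (deep-below deep uc um) (One-child-Two deep one uc) (clean-below clean uc um))

  two-clean₃ : ∀ j → Deep (3 + j) u → Two u → Clean (3 + j) u → Many 4 (Descends (3 + j) u)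
  two-clean₃ j deep (a , b , a≢b , ua , ub) clean =
    fork (deep-≤ (n≤1+n (2 + j)) deep) ua ub a≢b uma umb (descend ua uma) (descend ub umb)
    where
    uma = clean-unmarked clean ua
    umb = clean-unmarked clean ub
    descend : ∀ {c} → Child _ c → Unmarked c → Many 2 (Descends (2 + j) c)
    descend uc um = clean₂ j (deep-below deep uc um) (clean-below clean uc um)

  clean₄ : ∀ j → Deep (4 + j) u → Clean (4 + j) u → Many 4 (Descends (4 + j) u)
  clean₄ j deep clean with kind deep
  ... | inj₁ two = two-clean₃ (suc j) deep two clean
  ... | inj₂ one@(_ , c , _ , uc , _) =
    let um = clean-unmarked clean uc
    in single uc um (two-clean₃ j (deep-below deep uc um) (One-child-Two deep one uc) (clean-below clean uc um))

  AtMostOneEvent : ℕ → Fin n → Set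
  AtMostOneEvent k u = ∀ {i j e f} → i < k → j < k → Descends i u e → Descends j u f → Event e → Event f → e ≡ f

  atMostOne-below : AtMostOneEvent (suc k) u → Child u c → Unmarked c → AtMostOneEvent k c
  atMostOne-below one uc um i< j< es fs = one (s<s i<) (s<s j<) (below uc um es) (below uc um fs)

  above≢ : Child u c → Descends i c e → u ≢ e
  above≢ (_ , lc) us = level<⇒≢ (≤-trans (≤-reflexive (sym lc)) (Descends-level≤ us))

  -- If both children are unmarked, each of them has a descendant. If one is marked, `u` itself is
  -- the single event, so the other branch is clean and yields two descendants alone.
  two-event₃ : ∀ j → Deep (3 + j) u → Two u → AllAlive (3 + j) u → AtMostOneEvent (3 + j) u →
               Many 2 (Descends (3 + j) u)
  two-event₃ {u} j deep (a , b , a≢b , ua , ub) alive atMost with marked? a | marked? b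
  ... | no uma | no umb = fork (deep-≤ (n≤1+n (2 + j)) deep) ua ub a≢b uma umb
          (some-descendant (2 + j) (alive-below alive ua uma)) (some-descendant (2 + j) (alive-below alive ub umb))
  ... | yes ma | yes mb = ⊥-elim (a≢b (two-marked-children (proj₁ deep) (deep-level deep) ua ub ma mb))
  ... | yes ma | no umb = single ub umb (clean₂ j (deep-below deep ub umb)
          (λ (i , e , i< , es , ev) → above≢ ub es (atMost z<s (s<s i<) here (below ub umb es) (a , ua , ma) ev)))
  ... | no uma | yes mb = single ua uma (clean₂ j (deep-below deep ua uma)
          (λ (i , e , i< , es , ev) → above≢ ua es (atMost z<s (s<s i<) here (below ua uma es) (b , ub , mb) ev)))

  event₄ : ∀ j → Deep (4 + j) u → AllAlive (4 + j) u → AtMostOneEvent (4 + j) u →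
           Many 2 (Descends (4 + j) u)
  event₄ j deep alive atMost with kind deep
  ... | inj₁ two = two-event₃ (suc j) deep two alive atMost
  ... | inj₂ one =
    let c , uc , um = alive z<s here
    in single uc um (two-event₃ j (deep-below deep uc um) (One-child-Two deep one uc)
         (alive-below alive uc um) (atMostOne-below atMost uc um))

  conflict : Deep k u → Descends i u e → Descends j u f → i ≤ k → j ≤ k → i + j ≤ 11 →
             Event e → Event f → e ≢ f → Upper e f ⊎ Upper f e
  conflict deep es fs i≤k j≤k i+j≤11 = event-pair
    (proj₁ de) (proj₁ df) (deep-level de) (deep-level df)
    (within-≤ G i+j≤11 (within-trans G (within-sym G (Descends-near es)) (Descends-near fs)))
    where
    de = deep-descends deep es i≤k
    df = deep-descends deep fs j≤k

  conflict-¬One : Upper e f ⊎ Upper f e → ¬ One e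
  conflict-¬One (inj₁ U) = Upper.¬One-upper U
  conflict-¬One (inj₂ U) = Upper.¬One-lower U

  conflict-levels : Upper e f ⊎ Upper f e → level f ≡ suc (level e) ⊎ level e ≡ suc (level f)
  conflict-levels (inj₁ U) = inj₁ (Upper.level-b U)
  conflict-levels (inj₂ U) = inj₂ (Upper.level-b U)

  conflict-level≤ : Upper e f ⊎ Upper f e → level f ≤ suc (level e)
  conflict-level≤ (inj₁ U) = ≤-reflexive (Upper.level-b U)
  conflict-level≤ (inj₂ U) = m≤n⇒m≤1+n (≤-trans (n≤1+n _) (≤-reflexive (sym (Upper.level-b U))))

  private
    -- Three numbers cannot differ by one pairwise, since two of them have the same parity.
    no-triangle : ∀ {x y z : ℕ} → y ≡ suc x ⊎ x ≡ suc y → z ≡ suc x ⊎ x ≡ suc z → z ≡ suc y ⊎ y ≡ suc z → ⊥ᵗ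
    no-triangle (inj₁ refl) (inj₁ refl) (inj₁ p) = 1+n≢n (sym p)
    no-triangle (inj₁ refl) (inj₁ refl) (inj₂ p) = 1+n≢n (sym p)
    no-triangle (inj₁ refl) (inj₂ refl) (inj₁ p) = m≢1+n+m _ {2} p
    no-triangle (inj₁ refl) (inj₂ refl) (inj₂ p) = 1+n≢n p
    no-triangle (inj₂ refl) (inj₁ refl) (inj₁ p) = 1+n≢n p
    no-triangle (inj₂ refl) (inj₁ refl) (inj₂ p) = m≢1+n+m _ {2} p
    no-triangle (inj₂ refl) (inj₂ p) (inj₁ refl) = 1+n≢n (sym p)
    no-triangle (inj₂ refl) (inj₂ p) (inj₂ refl) = 1+n≢n p

  -- One block of six levels.

  module Root (deep : Deep 6 u) where

    EarlyEvent : Fin n → Set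
    EarlyEvent e = ∃[ i ] i ≤ 5 × Descends i u e × Event e

    early-conflict : EarlyEvent e → EarlyEvent f → e ≢ f → Upper e f ⊎ Upper f e
    early-conflict (i , i≤5 , es , ev) (j , j≤5 , fs , fv) = conflict deep es fs
      (m≤n⇒m≤1+n i≤5) (m≤n⇒m≤1+n j≤5) (≤-trans (+-mono-≤ i≤5 j≤5) (n≤1+n 10)) ev fv

    no-three-events : EarlyEvent e → EarlyEvent f → EarlyEvent g → e ≢ f → e ≢ g → f ≢ g → ⊥ᵗ
    no-three-events e f g e≢f e≢g f≢g = no-triangle
      (conflict-levels (early-conflict e f e≢f))
      (conflict-levels (early-conflict e g e≢g))
      (conflict-levels (early-conflict f g f≢g))

    -- Used with `w` equal to `u` (`i = 0`, `j = 1`) or to the only child of `u` (`i = 1`, `j = 0`);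
    -- in both cases `w` has two children and the block ends at depth six below `u`.
    module _ {w : Fin n} (i j : ℕ) (us : Descends i u w) (i+5+j≤6 : i + (5 + j) ≤ 6) where

      deep-w : Deep (5 + j) w
      deep-w = deep-≤ (m+n≤o⇒m≤o∸n (5 + j) (≤-trans (≤-reflexive (+-comm (5 + j) i)) i+5+j≤6))
        (deep-descends deep us (m+n≤o⇒m≤o i i+5+j≤6))

      early-below : Child w c → Unmarked c → k < 4 + j → Descends k c e → Event e → EarlyEvent e
      early-below {k = k} wc um k< es ev = i + suc k ,
        s≤s⁻¹ (≤-trans (≤-reflexive (sym (+-suc i (suc k)))) (≤-trans (+-monoʳ-≤ i (s≤s k<)) i+5+j≤6)) ,
        Descends-trans us (below wc um es) , ev

      -- With an event `g` outside the branch, a dead node inside would conflict with `g`, and two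
      -- events inside would be three together with `g`.
      one-event-side : Child w c → Unmarked c → EarlyEvent g →
                       (∀ {k e} → k < 4 + j → Descends k c e → e ≢ g) → Many 2 (Descends (4 + j) c)
      one-event-side {c} {g} wc um early-g away = event₄ j deep-c alive atMost
        where
        deep-c : Deep (4 + j) c
        deep-c = deep-below deep-w wc um

        alive : AllAlive (4 + j) c
        alive k< es with Alive⊎Dead (deep-descends deep-c es (<⇒≤ k<))
        ... | inj₁ al = al
        ... | inj₂ (one , ev) = ⊥-elim (conflict-¬One
                (early-conflict (early-below wc um k< es ev) early-g (away k< es)) one)

        atMost : AtMostOneEvent (4 + j) c
        atMost {e = e} {f} k< l< es fs ev fv with e ≟ᶠ f
        ... | yes eq = eq
        ... | no e≢f = ⊥-elim (no-three-events (early-below wc um k< es ev) (early-below wc um l< fs fv) early-g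
                e≢f (away k< es) (away l< fs))

      -- A branch without early events gives four descendants by itself. If both branches have one,
      -- each event acts as the outside event for the other branch, and each branch gives two.
      unmarked-fork : Child w a → Child w b → a ≢ b → Unmarked a → Unmarked b → Many 4 (Descends (5 + j) w)
      unmarked-fork {a} {b} wa wb a≢b uma umb with hasEvent? (4 + j) a | hasEvent? (4 + j) b
      ... | no clean | _ = single wa uma (clean₄ j (deep-below deep-w wa uma) clean)
      ... | yes _ | no clean = single wb umb (clean₄ j (deep-below deep-w wb umb) clean)
      ... | yes (k , e , k< , es , ev) | yes (l , f , l< , fs , fv) =
        fork (deep-≤ (n≤1+n (4 + j)) deep-w) wa wb a≢b uma umb
          (one-event-side wa uma (early-below wb umb l< fs fv)
            (λ { m< as refl → a≢b (disjoint l< as fs) }))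
          (one-event-side wb umb (early-below wa uma k< es ev)
            (λ { m< bs refl → a≢b (disjoint m< es bs) }))
        where
        disjoint : ∀ {k l z} → l < 4 + j → Descends k a z → Descends l b z → a ≡ b
        disjoint l< as bs = Descends-disjoint (children-level wa wb) as bs
          (deep-bound deep-w (below wb umb bs) (≤-trans l< (m≤n+m (4 + j) 2)))

      -- `w` is an event, so an event below `z` must be on the next level, which leaves only `z`
      -- itself. Then `z` is not dead, its unmarked child `x` has two children, and nothing below
      -- `x` is an event: four descendants appear three levels below `x`, making up for the lost
      -- branch.
      marked-fork : Child w c → Marked c → Child w z → Unmarked z → Many 4 (Descends (5 + j) w)
      marked-fork {c} {z} wc mc wz umz with hasEvent? (4 + j) z
      ... | no clean = single wz umz (clean₄ j (deep-below deep-w wz umz) clean)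
      ... | yes (k , e , k< , es , ev) =
        second (early-conflict early-w (early-below wz umz k< es ev) (above≢ wz es)) k< es ev
        where
        deep-z : Deep (4 + j) z
        deep-z = deep-below deep-w wz umz

        early-w : EarlyEvent w
        early-w = i , s≤s⁻¹ (≤-trans (≤-trans (≤-reflexive (+-comm 1 i)) (+-monoʳ-≤ i (s≤s z≤n))) i+5+j≤6) , us , c , wc , mc

        -- Such an event would be at least two levels below `w`, while conflicting events are one
        -- level apart.
        too-far : ∀ {l f} → Child z x → Unmarked x → l < 3 + j → Descends l x f → ¬ Event f
        too-far zx umx k< es ev = <-irrefl refl (≤-trans
          (≤-trans (≤-reflexive (sym (trans (proj₂ zx) (cong suc (proj₂ wz))))) (Descends-level≤ es))
          (conflict-level≤ (early-conflict early-w (early-below wz umz (s<s k<) (below zx umx es) ev)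
            (above≢ wz (below zx umx es)))))

        second : ∀ {l f} → Upper w f ⊎ Upper f w → l < 4 + j → Descends l z f → Event f → Many 4 (Descends (5 + j) w)
        second (inj₂ U) k< es ev = ⊥-elim (<-asym (≤-reflexive (sym (Upper.level-b U)))
          (≤-trans (≤-reflexive (sym (proj₂ wz))) (Descends-level≤ es)))
        second (inj₁ U) (s<s k<) (below zx umx es) ev = ⊥-elim (too-far zx umx k< es ev)
        second (inj₁ U) k< here ev with Alive⊎Dead deep-z
        ... | inj₂ (one , _) = ⊥-elim (Upper.¬One-lower U one)
        ... | inj₁ (x , zx , umx) with kind (deep-below deep-z zx umx)
        ...   | inj₂ one = ⊥-elim (Upper.¬One-sibling U zx umx one)
        ...   | inj₁ two = single wz umz (single zx umx (two-clean₃ j (deep-below deep-z zx umx) two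
                  (λ (k , e , k< , es , ev) → too-far zx umx k< es ev)))

      forked : Two w → Many 4 (Descends (5 + j) w)
      forked (a , b , a≢b , wa , wb) with marked? a | marked? b
      ... | no uma | no umb = unmarked-fork wa wb a≢b uma umb
      ... | yes ma | no umb = marked-fork wa ma wb umb
      ... | no uma | yes mb = marked-fork wb mb wa uma
      ... | yes ma | yes mb =
        ⊥-elim (a≢b (two-marked-children (proj₁ deep-w) (deep-level deep-w) wa wb ma mb))

    leaves : Alive u → Many 4 (Descends 6 u)
    leaves (c , uc , um) with kind deep
    ... | inj₁ two = forked 0 1 here ≤-refl two
    ... | inj₂ one = single uc um (forked 1 0 (below uc um here) ≤-refl (One-child-Two deep one uc))

    alive-leaves : Alive u → Many 4 (λ w → Descends 6 u w × Alive w)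
    alive-leaves alive with hasEvent? 6 u
    ... | yes (i , e , s≤s i≤5 , es , ev) = many-map (λ ws → ws , survives ws) (leaves alive)
      where
      survives : ∀ {w} → Descends 6 u w → Alive w
      survives ws with Alive⊎Dead (deep-descends deep ws ≤-refl)
      -- A dead leaf would be an event six levels down, in conflict with the event at depth at most
      -- five; no party to a conflict is dead.
      ... | inj₁ al = al
      ... | inj₂ (one , wv) = ⊥-elim (conflict-¬One
              (conflict deep ws es ≤-refl (m≤n⇒m≤1+n i≤5) (+-monoʳ-≤ 6 i≤5) wv ev
                (level>⇒≢ (≤-trans (≤-reflexive (cong suc (Descends-level es)))
                  (≤-trans (s≤s (+-monoˡ-≤ (level u) i≤5)) (≤-reflexive (sym (Descends-level ws)))))))
              one)
    ... | no clean = many-map (λ (x , xs , ws , al) → Descends-trans xs ws , al)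
      -- Without events there are two nodes at depth two with four leaves each. Two leaves of `u`
      -- may be twelve steps apart, too far to be compared, but under one `x` they are at most eight
      -- apart, so each `x` loses at most one leaf. Of the three that remain two are kept, which
      -- gives 2 * 2.
      (many-bind {B = λ x w → Descends 4 x w × Alive w}
        (clean₂ 0 (deep-≤ (s≤s (s≤s z≤n)) deep) (λ (i , e , i< , rest) → clean (i , e , ≤-trans i< (s≤s (s≤s z≤n)) , rest)))
        (λ xs → many-≤ (n≤1+n 2) (many-drop (split xs) (one-dead xs) (clean₄ 0 (deep-x xs) (clean-x xs))))
        (λ xs ys (ws , _) (ws′ , _) → same-ancestor ws ws′ (deep-bound (deep-x xs) ws (n≤1+n 4))))
      where
      deep-x : Descends 2 u x → Deep 4 x
      deep-x xs = deep-descends deep xs (s≤s (s≤s z≤n))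

      clean-x : Descends 2 u x → Clean 4 x
      clean-x xs (i , e , i<4 , es , ev) = clean (2 + i , e , s<s (s<s i<4) , Descends-trans xs es , ev)

      split : Descends 2 u x → Descends 4 x w → (Descends 4 x w × Alive w) ⊎ Dead w
      split xs ws with Alive⊎Dead (deep-descends (deep-x xs) ws ≤-refl)
      ... | inj₁ al = inj₁ (ws , al)
      ... | inj₂ dd = inj₂ dd

      one-dead : Descends 2 u x → Descends 4 x w → Descends 4 x z → Dead w → Dead z → w ≡ z
      one-dead {w = w} {z} xs ws zs (one , wv) (_ , zv) with w ≟ᶠ z
      ... | yes eq = eq
      ... | no w≢z = ⊥-elim (conflict-¬One
              (conflict (deep-x xs) ws zs ≤-refl ≤-refl (m≤n+m 8 3) wv zv w≢z) one)

  -- The last block and the induction over blocks.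

  Below : Fin n → Fin n → Set
  Below u w = ∃[ i ] Descends i u w × level w ≤ r

  -- The dead node `c` has a horizontal edge, so `u` has none and has two children. A marked sibling
  -- would make `u` an event in conflict with the event `c`, which is impossible for a dead `c`.
  live-sibling : Deep (suc k) u → Child u c → Unmarked c → Dead c →
                 ∃[ d ] c ≢ d × Child u d × Unmarked d
  live-sibling {k} {u} {c} deep uc umc (one , cv) with kind deep
  ... | inj₂ one-u with One-child-Two deep one-u uc
  ...   | two-c = ⊥-elim (child-horizontal uc (proj₁ (proj₂ (proj₂ one-u))) (proj₁ (proj₂ (proj₂ one)))
                    (level-child≤ uc (deep-level deep)))
  live-sibling {k} {u} {c} deep uc umc (one , cv) | inj₁ (a , b , a≢b , ua , ub) = choose (c ≟ᶠ a)
    where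
    unmarked : ∀ {d} → Child u d → Unmarked d
    unmarked ud md = conflict-¬One (conflict deep (below uc umc here) here (s≤s z≤n) z≤n (s≤s z≤n)
      cv (_ , ud , md) (level>⇒≢ (≤-reflexive (sym (proj₂ uc))))) one

    choose : Dec (c ≡ a) → ∃[ d ] c ≢ d × Child u d × Unmarked d
    choose (yes refl) = b , a≢b , ub , unmarked ub
    choose (no c≢a)   = a , c≢a , ua , unmarked ua

  -- A chain of unmarked nodes below `u` is followed as long as it lasts. Where it stops at a dead
  -- node, an unmarked sibling of that node takes over, and two siblings are not both dead.
  four-below : Deep 3 u → Alive u → Many 4 (Below u)
  four-below {u} deep (z , uz , umz) with Alive⊎Dead (deep-below deep uz umz)
  ... | inj₂ (one-z , zv) = second (live-sibling deep uz umz (one-z , zv))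
    where
    second : ∃[ d ] z ≢ d × Child u d × Unmarked d → Many 4 (Below u)
    second (d , z≢d , ud , umd) with Alive⊎Dead (deep-below deep ud umd)
    ... | inj₂ (_ , dv) = ⊥-elim (conflict-¬One (conflict deep (below uz umz here) (below ud umd here)
            (s≤s z≤n) (s≤s z≤n) (s≤s (s≤s z≤n)) zv dv z≢d) one-z)
    ... | inj₁ (x , dx , umx) = u ∷ z ∷ d ∷ x ∷ [] , ≤-refl ,
      ((above≢ uz here ∷ above≢ ud here ∷ above≢ ud (below dx umx here) ∷ []) ∷
       (z≢d ∷ level<⇒≢ (≤-reflexive (trans (cong suc (children-level uz ud)) (sym (proj₂ dx)))) ∷ []) ∷
       (above≢ dx here ∷ []) ∷ [] ∷ []) ,
      at here z≤n ∷ at (below uz umz here) (s≤s z≤n) ∷ at (below ud umd here) (s≤s z≤n) ∷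
      at (below ud umd (below dx umx here)) (s≤s (s≤s z≤n)) ∷ []
      where
      at : Descends i u w → i ≤ 4 → Below u w
      at ws i≤4 = _ , ws , deep-bound deep ws i≤4
  ... | inj₁ (y , zy , umy) = third (Alive⊎Dead (deep-below (deep-below deep uz umz) zy umy))
    where
    at : Descends i u w → i ≤ 4 → Below u w
    at ws i≤4 = _ , ws , deep-bound deep ws i≤4

    third : Alive y ⊎ Dead y → Many 4 (Below u)
    third (inj₁ (x , yx , umx)) = u ∷ z ∷ y ∷ x ∷ [] , ≤-refl ,
      ((above≢ uz here ∷ above≢ uz (below zy umy here) ∷ above≢ uz (below zy umy (below yx umx here)) ∷ []) ∷
       (above≢ zy here ∷ above≢ zy (below yx umx here) ∷ []) ∷ (above≢ yx here ∷ []) ∷ [] ∷ []) ,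
      at here z≤n ∷ at (below uz umz here) (s≤s z≤n) ∷ at (below uz umz (below zy umy here)) (s≤s (s≤s z≤n)) ∷
      at (below uz umz (below zy umy (below yx umx here))) (s≤s (s≤s (s≤s z≤n))) ∷ []
    third (inj₂ dead) =
      let x , y≢x , zx , umx = live-sibling (deep-below deep uz umz) zy umy dead
      in u ∷ z ∷ y ∷ x ∷ [] , ≤-refl ,
      ((above≢ uz here ∷ above≢ uz (below zy umy here) ∷ above≢ uz (below zx umx here) ∷ []) ∷
       (above≢ zy here ∷ above≢ zx here ∷ []) ∷ (y≢x ∷ []) ∷ [] ∷ []) ,
      at here z≤n ∷ at (below uz umz here) (s≤s z≤n) ∷ at (below uz umz (below zy umy here)) (s≤s (s≤s z≤n)) ∷
      at (below uz umz (below zx umx here)) (s≤s (s≤s z≤n)) ∷ []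

  growth : ∀ m → Reached u → Alive u → suc m * 6 + level u ≤ r → Many (4 ^ suc m) (Below u)
  growth {u} zero ru alive u≤ = four-below (ru , ≤-trans (+-monoˡ-≤ (level u) (n≤1+n 5)) u≤) alive
  growth {u} (suc m) ru alive u≤ = many-map
    (λ (w , (ws , _) , j , xs , x≤r) → 6 + j , Descends-trans ws xs , x≤r)
    (many-bind {B = Below} (Root.alive-leaves deep alive)
      (λ (ws , al) → growth m (Descends-reached ru ws) al
        (≤-trans (≤-reflexive (trans (cong (suc m * 6 +_) (Descends-level ws)) (rearrange (suc m * 6) (level u)))) u≤))
      (λ (ws , _) (ws′ , _) (_ , xs , x≤r) (_ , ys , _) →
        Descends-disjoint (trans (Descends-level ws) (sym (Descends-level ws′))) xs ys x≤r))
    where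
    rearrange : ∀ a b → a + (6 + b) ≡ 6 + a + b
    rearrange a b = trans (sym (+-assoc a 6 b)) (cong (_+ b) (+-comm a 6))

    deep : Deep 6 u
    -- `Deep 6` takes eight levels; here at least two blocks, hence twelve levels, remain.
    deep = ru , ≤-trans (+-monoˡ-≤ (level u) (m≤m+n 8 (4 + m * 6))) u≤

-- Conclusion.

tNode? : ∀ {n} {G : Graph n} (M : Marking G 15) u → Dec (Marking.TNode M u)
tNode? {G = G} M u = any? λ x → any? λ y →
  ¬? (x ≟ᶠ y) ×-dec adj? G u x ×-dec adj? G u y ×-dec Marks.marked? M x ×-dec Marks.marked? M y

lemma16 : ∀ {n : ℕ} (G : Graph n) (r : ℕ) → 6 ∣ r →
    Nice G → MaxDegree G 3 →
    ¬ (∃[ S ] DCC G S × RadiusAtMost G r S) →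
    (M : Marking G 15) (v : Fin n) → Marking.Unmarked M v →
    (∀ u → N G r v u → Graph.deg G u ≡ 3) →
    (∃[ u ] Marking.HopComponent M r v u × Marking.TNode M u)
    ⊎ AtLeast (4 ^ (r / 6)) (Marking.HopComponent M r v)
lemma16 {n} G r (divides q r≡q*6) (connected , _ , _ , ¬clique) (deg≤3 , _) noDCC M v unmarked deg≡3
  -- The disjunction is settled by a search for a reached T-node; the counting argument runs in the
  -- case that there is none.
  with any? (λ u → within? G (Marks.unmarked? M) r v u ×-dec tNode? M u)
... | yes t = inj₁ t
... | no ¬t = inj₂ (subst (λ k → AtLeast (4 ^ k) (HopComponent r v)) (sym r/6≡q)
                (many⇒AtLeast (count q (≤-reflexive (sym r≡q*6)))))
  where
  open Marking M

  dist = distances G connected v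
  open Distances dist

  sparse : Sparse G v r
  sparse = record
    { distance  = dist
    ; connected = connected
    ; notClique = ¬clique
    ; deg≤3     = deg≤3
    ; deg≡3     = λ u u≤r → deg≡3 u (level u , u≤r , geodesic u)
    ; noDCC     = noDCC
    }

  noTNode : ∀ {s} → HopComponent r v s → ¬ TNode s
  noTNode h t = ¬t (_ , h , t)

  open Structure sparse using (Horizontal-pos)
  open Events sparse M noTNode
  open Growth sparse M noTNode

  r/6≡q : r / 6 ≡ q
  r/6≡q = trans (cong (_/ 6) r≡q*6) (m*n/n≡m q 6)

  level-v : level v ≡ 0
  level-v = n≤0⇒n≡0 (shortest (stop _))

  reached-v : Reached v
  reached-v = 0 , z≤n , stop unmarked

  count : ∀ q → q * 6 ≤ r → Many (4 ^ q) (HopComponent r v)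
  count zero    _  = many-one (0 , z≤n , stop unmarked)
  count (suc m) le = many-map
    (λ (_ , ws , w≤r) → within-≤ G w≤r (Descends-reached reached-v ws))
    (growth m reached-v alive (≤-trans (≤-reflexive (trans (cong (suc m * 6 +_) level-v) (+-identityʳ _))) le))
    where
    deep-v : Deep 4 v
    deep-v = reached-v , ≤-trans (s≤s (s≤s (≤-reflexive (cong (4 +_) level-v)))) (≤-trans (m≤m+n 6 (m * 6)) le)

    alive : Alive v
    alive with Alive⊎Dead deep-v
    ... | inj₁ al = al
    -- The source is alone on level 0, so it has no horizontal edge and cannot be dead.
    ... | inj₂ ((_ , _ , h , _) , _) = case subst (0 <_) level-v (Horizontal-pos h) of λ ()
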